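{- Let $a<b$ and $c<d$ be integers and let $f(x,y)$ be a function of two variables whose partial derivatives up to second order are continuous in the rectangle $a\le x\le b$, $c\le y\le d$. Then $$\sum_{c<n\le d}\ \sum_{a<m\le b}f(m,n)=\int_a^b\!\int_c^d f(x,y)\,dy\,dx+\int_a^b\!\int_c^d f_x(x,y)(x-[x])\,dy\,dx+\int_a^b\!\int_c^d f_y(x,y)(y-[y])\,dy\,dx+\int_a^b\!\int_c^d f_{xy}(x,y)(x-[x])(y-[y])\,dy\,dx .$$
   Context: $[x]$ denotes the integral part (floor) of the real number $x$; $f_x,f_y,f_{xy}$ denote partial derivatives. In each double integral $x$ ranges over $[a,b]$ and $y$ over $[c,d]$; the sums run over integers $m,n$. -}

module Defs where

open import Level using (0ℓ)
open import Algebra.Bundles using (CommutativeRing)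
open import Axiom.ExcludedMiddle using (ExcludedMiddle)
open import Data.Empty using (⊥-elim)
open import Data.Fin.Base using (toℕ)
open import Data.Integer.Base as ℤ using (ℤ; +_; -[1+_])
open import Data.Nat.Base as ℕ using (ℕ; zero; suc)
open import Data.Product.Base using (Σ; ∃; _×_; _,_; proj₁; proj₂)
open import Data.Sum.Base using (inj₁; inj₂)
open import Data.Unit.Base using (⊤)
open import Relation.Binary.Bundles using (TotalOrder)
open import Relation.Binary.Core using (Rel)
open import Relation.Binary.Structures using (IsTotalOrder)
open import Relation.Nullary using (¬_; yes; no)
open import Relation.Unary using (Pred; Satisfiable)
import Algebra.Construct.NaturalChoice.Max as Max
import Algebra.Definitions.RawMonoid as RawMonoidDefinitions
import Algebra.Properties.Ring as RingProperties
import Relation.Binary.Construct.NonStrictToStrict as ToStrict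
import Relation.Binary.Reasoning.Setoid as SetoidReasoning

-- The standard axioms of the real line.  They determine ℝ up to unique
-- isomorphism; every statement below is made for an arbitrary model.

record CompleteOrderedField : Set₁ where
  field
    commutativeRing : CommutativeRing 0ℓ 0ℓ

  open CommutativeRing commutativeRing public renaming (Carrier to ℝ)

  infix 4 _≤_
  field
    _≤_          : Rel ℝ 0ℓ
    isTotalOrder : IsTotalOrder _≈_ _≤_
    0≉1          : ¬ (0# ≈ 1#)
    inverse      : ∀ x → ¬ (x ≈ 0#) → ∃ λ y → x * y ≈ 1#
    +-monoˡ-≤    : ∀ z {x y} → x ≤ y → x + z ≤ y + z
    *-nonNeg     : ∀ {x y} → 0# ≤ x → 0# ≤ y → 0# ≤ x * y

  IsUpperBound : Pred ℝ 0ℓ → ℝ → Set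
  IsUpperBound P u = ∀ x → P x → x ≤ u

  IsSupremum : Pred ℝ 0ℓ → ℝ → Set
  IsSupremum P s = IsUpperBound P s × (∀ u → IsUpperBound P u → s ≤ u)

  field
    supremum : (P : Pred ℝ 0ℓ) → Satisfiable P → ∃ (IsUpperBound P) →
               ∃ (IsSupremum P)

  totalOrder : TotalOrder 0ℓ 0ℓ 0ℓ
  totalOrder = record { isTotalOrder = isTotalOrder }

-- Excluded middle is needed for [x], a discontinuous function, to be defined
-- on all of ℝ.

module Analysis (em : ExcludedMiddle 0ℓ) (R : CompleteOrderedField) where

  open CompleteOrderedField R public
  open ToStrict _≈_ _≤_ public using (_<_)
  open Max totalOrder public using (_⊔_)
  open RawMonoidDefinitions +-rawMonoid public using (sum) renaming (_×_ to _·_)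

  ∣_∣ : ℝ → ℝ
  ∣ x ∣ = x ⊔ (- x)

  fromℤ : ℤ → ℝ
  fromℤ (+ n)    = n · 1#
  fromℤ -[1+ n ] = - (suc n · 1#)

  IsFloor : ℝ → ℤ → Set
  IsFloor x k = fromℤ k ≤ x × x < fromℤ k + 1#

  private
    module ≤ = IsTotalOrder isTotalOrder
    open RingProperties ring using (-‿involutive; -‿+-comm; -0#≈0#; -1*x≈-x)
    open SetoidReasoning setoid

    ≤-resp : ∀ {x x′ y y′} → x ≈ x′ → y ≈ y′ → x ≤ y → x′ ≤ y′
    ≤-resp p q r = ≤.trans (≤.reflexive (sym p)) (≤.trans r (≤.reflexive q))

    ≰⇒> : ∀ {x y} → ¬ (x ≤ y) → y < x
    ≰⇒> = ToStrict.≰⇒> _≈_ _≤_ sym ≤.reflexive ≤.total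

    x+y-y≈x : ∀ x y → (x + y) + - y ≈ x
    x+y-y≈x x y = begin
      (x + y) + - y ≈⟨ +-assoc x y (- y) ⟩
      x + (y + - y) ≈⟨ +-congˡ (-‿inverseʳ y) ⟩
      x + 0#        ≈⟨ +-identityʳ x ⟩
      x             ∎

    x-y+y≈x : ∀ x y → (x + - y) + y ≈ x
    x-y+y≈x x y = begin
      (x + - y) + y ≈⟨ +-assoc x (- y) y ⟩
      x + (- y + y) ≈⟨ +-congˡ (-‿inverseˡ y) ⟩
      x + 0#        ≈⟨ +-identityʳ x ⟩
      x             ∎

    -x≤y⇒-y≤x : ∀ {x y} → - x ≤ y → - y ≤ x
    -x≤y⇒-y≤x {x} {y} h =
      ≤-resp lhs (trans (+-comm y _) (x-y+y≈x x y)) (+-monoˡ-≤ (x + - y) h)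
      where
      lhs : - x + (x + - y) ≈ - y
      lhs = begin
        - x + (x + - y) ≈⟨ +-assoc (- x) x (- y) ⟨
        (- x + x) + - y ≈⟨ +-congʳ (-‿inverseˡ x) ⟩
        0# + - y        ≈⟨ +-identityˡ (- y) ⟩
        - y             ∎

    1≰0 : ¬ (1# ≤ 0#)
    1≰0 1≤0 = 0≉1 (≤.antisym 0≤1 1≤0)
      where
      0≤-1 : 0# ≤ - 1#
      0≤-1 = ≤-resp (-‿inverseʳ 1#) (+-identityˡ (- 1#)) (+-monoˡ-≤ (- 1#) 1≤0)
      0≤1 : 0# ≤ 1#
      0≤1 = ≤-resp refl (trans (-1*x≈-x (- 1#)) (-‿involutive 1#))
                   (*-nonNeg 0≤-1 0≤-1)

    ℕ-unbounded : ∀ x → ¬ (∀ n → n · 1# ≤ x)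
    ℕ-unbounded x h
      with supremum (λ z → ∃ λ n → z ≈ n · 1#) (0# , 0 , refl)
                    (x , λ z (n , z≈n) → ≤-resp (sym z≈n) refl (h n))
    ... | s , ub , least = 1≰0 (≤-resp lhs (-‿inverseʳ s) s+1-s≤s-s)
      where
      s≤s-1 : s ≤ s + - 1#
      s≤s-1 = least (s + - 1#) λ z (n , z≈n) →
        ≤-resp (trans (+-congʳ (+-comm 1# _)) (trans (x+y-y≈x _ 1#) (sym z≈n))) refl
               (+-monoˡ-≤ (- 1#) (ub (suc n · 1#) (suc n , refl)))
      s+1-s≤s-s : (s + 1#) + - s ≤ s + - s
      s+1-s≤s-s = +-monoˡ-≤ (- s) (≤-resp refl (x-y+y≈x s 1#) (+-monoˡ-≤ 1# s≤s-1))
      lhs : (s + 1#) + - s ≈ 1#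
      lhs = trans (+-congʳ (+-comm s 1#)) (x+y-y≈x 1# s)

    fromℤ-suc : ∀ k → fromℤ (ℤ.suc k) ≈ fromℤ k + 1#
    fromℤ-suc (+ n)          = +-comm 1# (n · 1#)
    fromℤ-suc -[1+ zero ]    = sym (trans (+-congʳ (-‿cong (+-identityʳ 1#))) (-‿inverseˡ 1#))
    fromℤ-suc -[1+ (suc n) ] = begin
      - y                  ≈⟨ x-y+y≈x (- y) 1# ⟨
      (- y + - 1#) + 1#    ≈⟨ +-congʳ (+-comm (- y) (- 1#)) ⟩
      (- 1# + - y) + 1#    ≈⟨ +-congʳ (-‿+-comm 1# y) ⟩
      - (1# + y) + 1#      ∎
      where y = suc n · 1#

    fromℤ-neg : ∀ n → fromℤ (ℤ.- (+ n)) ≈ - (n · 1#)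
    fromℤ-neg zero    = sym -0#≈0#
    fromℤ-neg (suc n) = refl

  archimedean : ∀ x → ∃ λ n → x < n · 1#
  archimedean x with em {∃ λ n → x < n · 1#}
  ... | yes p = p
  ... | no ¬p = ⊥-elim (ℕ-unbounded x bounded)
    where
    bounded : ∀ n → n · 1# ≤ x
    bounded n with em {n · 1# ≤ x}
    ... | yes n≤x = n≤x
    ... | no n≰x  = ⊥-elim (¬p (n , ≰⇒> n≰x))

  private
    search : ∀ x j k → fromℤ k ≤ x → ¬ (fromℤ k + j · 1# ≤ x) → ∃ (IsFloor x)
    search x zero    k k≤x k+j≰x = ⊥-elim (k+j≰x (≤-resp (sym (+-identityʳ _)) refl k≤x))
    search x (suc j) k k≤x k+j≰x with em {fromℤ k + 1# ≤ x}
    ... | no  k+1≰x = k , k≤x , ≰⇒> k+1≰x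
    ... | yes k+1≤x = search x j (ℤ.suc k) (≤-resp (sym (fromℤ-suc k)) refl k+1≤x)
                        λ h → k+j≰x (≤-resp (trans (+-congʳ (fromℤ-suc k)) (+-assoc _ _ _)) refl h)

    ·-+ : ∀ m n → (m ℕ.+ n) · 1# ≈ m · 1# + n · 1#
    ·-+ zero    n = sym (+-identityˡ _)
    ·-+ (suc m) n = trans (+-congˡ (·-+ m n)) (sym (+-assoc _ _ _))

  floor : ∀ x → ∃ (IsFloor x)
  floor x with archimedean x | archimedean (- x)
  ... | n , (x≤n , x≉n) | m , (-x≤m , _) =
    search x (m ℕ.+ n) (ℤ.- (+ m))
      (≤-resp (sym (fromℤ-neg m)) refl (-x≤y⇒-y≤x -x≤m))
      λ h → x≉n (≤.antisym x≤n (≤-resp eq refl h))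
    where
    eq : fromℤ (ℤ.- (+ m)) + (m ℕ.+ n) · 1# ≈ n · 1#
    eq = begin
      fromℤ (ℤ.- (+ m)) + (m ℕ.+ n) · 1#   ≈⟨ +-cong (fromℤ-neg m) (·-+ m n) ⟩
      - (m · 1#) + (m · 1# + n · 1#)       ≈⟨ +-assoc _ _ _ ⟨
      (- (m · 1#) + m · 1#) + n · 1#       ≈⟨ +-congʳ (-‿inverseˡ _) ⟩
      0# + n · 1#                          ≈⟨ +-identityˡ _ ⟩
      n · 1#                               ∎

  ⌊_⌋ : ℝ → ℤ
  ⌊ x ⌋ = proj₁ (floor x)

  -- For a ≤ b, the integers n with a < n ≤ b are a + 1 , … , a + ∣ b - a ∣.

  sumℤ : ℤ → ℤ → (ℤ → ℝ) → ℝ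
  sumℤ a b g = sum {ℤ.∣ b ℤ.- a ∣} λ i → g (a ℤ.+ + suc (toℕ i))

  infixl 10 sumℤ
  syntax sumℤ a b (λ n → e) = ∑[ a < n ≤ b ] e

  infix 4 _∈[_,_]

  _∈[_,_] : ℝ → ℝ → ℝ → Set
  x ∈[ a , b ] = a ≤ x × x ≤ b

  -- g′ is the derivative at x of g restricted to [a,b], hence a one-sided
  -- derivative when x is an endpoint.

  HasDerivativeAt : (a b : ℝ) (g : ℝ → ℝ) (g′ x : ℝ) → Set
  HasDerivativeAt a b g g′ x =
    ∀ ε → 0# < ε → ∃ λ δ → 0# < δ ×
      (∀ t → t ∈[ a , b ] → ∣ t - x ∣ < δ →
        ∣ (g t - g x) - g′ * (t - x) ∣ ≤ ε * ∣ t - x ∣)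

  -- Functions on the rectangle are given by arbitrary functions on ℝ × ℝ whose
  -- values outside it are irrelevant.  On the rectangle, compatibility with
  -- _≈_ follows from differentiability or continuity.

  module _ (a b c d : ℝ) where

    IsPartialX : (f f′ : ℝ → ℝ → ℝ) → Set
    IsPartialX f f′ = ∀ x y → x ∈[ a , b ] → y ∈[ c , d ] →
      HasDerivativeAt a b (λ t → f t y) (f′ x y) x

    IsPartialY : (f f′ : ℝ → ℝ → ℝ) → Set
    IsPartialY f f′ = ∀ x y → x ∈[ a , b ] → y ∈[ c , d ] →
      HasDerivativeAt c d (λ t → f x t) (f′ x y) y

    IsContinuous : (ℝ → ℝ → ℝ) → Set
    IsContinuous f = ∀ x y → x ∈[ a , b ] → y ∈[ c , d ] →
      ∀ ε → 0# < ε → ∃ λ δ → 0# < δ ×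
        (∀ s t → s ∈[ a , b ] → t ∈[ c , d ] → ∣ s - x ∣ < δ → ∣ t - y ∣ < δ →
          ∣ f s t - f x y ∣ < ε)

    -- fxy is the y-derivative of fx.  Continuity of f itself follows from
    -- that of fx and fy.

    record HasContinuousPartials² (f : ℝ → ℝ → ℝ) : Set where
      field
        fx fy fxx fxy fyx fyy : ℝ → ℝ → ℝ
        isPartial-fx  : IsPartialX f fx
        isPartial-fy  : IsPartialY f fy
        isPartial-fxx : IsPartialX fx fxx
        isPartial-fxy : IsPartialY fx fxy
        isPartial-fyx : IsPartialX fy fyx
        isPartial-fyy : IsPartialY fy fyy
        continuous-fx  : IsContinuous fx
        continuous-fy  : IsContinuous fy
        continuous-fxx : IsContinuous fxx
        continuous-fxy : IsContinuous fxy
        continuous-fyx : IsContinuous fyx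
        continuous-fyy : IsContinuous fyy

  -- Tagged partitions of [a,b], read from the left: the first subinterval is
  -- [a,p] with tag t, and the rest is a tagged partition of [p,b].

  data TaggedPartition : ℝ → ℝ → Set where
    nil  : ∀ {a b} → a ≈ b → TaggedPartition a b
    cons : ∀ {a b} (t p : ℝ) → t ∈[ a , p ] → TaggedPartition p b →
           TaggedPartition a b

  FinerThan : ∀ {a b} → ℝ → TaggedPartition a b → Set
  FinerThan     δ (nil _)        = ⊤
  FinerThan {a} δ (cons _ p _ P) = (p - a < δ) × FinerThan δ P

  riemannSum : ∀ {a b} → (ℝ → ℝ) → TaggedPartition a b → ℝ
  riemannSum     g (nil _)        = 0#
  riemannSum {a} g (cons t p _ P) = g t * (p - a) + riemannSum g P

  -- g is Riemann integrable on [a,b] with integral I; meaningful only for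
  -- a ≤ b, since otherwise [a,b] has no tagged partitions.

  HasIntegral : (a b : ℝ) (g : ℝ → ℝ) (I : ℝ) → Set
  HasIntegral a b g I =
    ∀ ε → 0# < ε → ∃ λ δ → 0# < δ ×
      (∀ (P : TaggedPartition a b) → FinerThan δ P → ∣ riemannSum g P - I ∣ < ε)

  -- ∫ₐᵇ ∫_c^d g(x,y) dy dx = I.

  HasIteratedIntegral : (a b c d : ℝ) (g : ℝ → ℝ → ℝ) (I : ℝ) → Set
  HasIteratedIntegral a b c d g I =
    ∃ λ (G : ℝ → ℝ) →
      (∀ x → x ∈[ a , b ] → HasIntegral c d (λ y → g x y) (G x)) ×
      HasIntegral a b G I

{-# OPTIONS --safe #-}
module Submission where

-- Call a function tame if it is bounded and, between consecutive integers,
-- uniformly continuous: continuous functions, x ↦ x - [x] and their products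
-- are tame.  Tame functions are integrable, and integration over y preserves
-- tameness in x, so that the four iterated integrals exist.
--
-- In one variable, g(x)(x - [x]) + Σ_{a < m ≤ [x]} g(m) is a continuous
-- primitive of g(x) + g′(x)(x - [x]), whence
--   Σ_{a < m ≤ b} g(m) = ∫ₐᵇ g(x) + g′(x)(x - [x]) dx.
-- Apply this to f( · ,n), sum over n, and then apply it under the integral
-- sign to f(x, · ) and to fx(x, · ).

open import Defs
open import Level using (0ℓ)
open import Axiom.ExcludedMiddle using (ExcludedMiddle)
open import Data.Empty using (⊥-elim)
open import Data.Fin.Base as Fin using (Fin)
open import Data.Fin.Properties using (toℕ-fromℕ; toℕ-inject₁; toℕ<n)
open import Data.Integer.Base as ℤ using (ℤ; +_; -[1+_])
open import Data.Maybe.Base as Maybe using ()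
open import Data.Nat.Base as ℕ using (ℕ; zero; suc)
open import Data.Product.Base using (Σ; ∃; ∃-syntax; _×_; _,_; proj₁; proj₂)
open import Data.Sum.Base using (_⊎_; inj₁; inj₂; [_,_]′)
open import Data.Unit.Base using (tt)
open import Relation.Binary.Bundles using (TotalOrder)
open import Relation.Binary.PropositionalEquality as ≡ using (_≡_)
open import Relation.Nullary using (¬_; Dec; yes; no)
open import Relation.Nullary.Decidable.Core using (dec⇒maybe)
open import Algebra.Solver.Ring.AlmostCommutativeRing
  using (fromCommutativeRing; _-Raw-AlmostCommutative⟶_)
import Algebra.Construct.NaturalChoice.Max as Max
import Algebra.Construct.NaturalChoice.MaxOp as MaxOp
import Algebra.Properties.CommutativeMonoid.Sum as CommutativeMonoidSum
import Algebra.Properties.Monoid.Sum as MonoidSum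
import Algebra.Properties.Ring as RingProperties
import Algebra.Properties.Semiring.Mult as Mult
import Algebra.Properties.Semiring.Mult.TCOptimised as Mult′
import Algebra.Properties.Semiring.Sum as SemiringSum
import Algebra.Solver.Ring as RingSolver
import Data.Integer.Properties as ℤ
import Relation.Binary.Construct.NonStrictToStrict as ToStrict
import Relation.Binary.Reasoning.Setoid as SetoidReasoning

-- The integrands jump where a coordinate is an integer, and the partitions in the definition of the
-- integral are arbitrary, so a subinterval may straddle an integer. Integrability therefore rests
-- on a primitive whose increments match the Riemann terms closely inside a unit cell and only up to
-- a Lipschitz error across an integer. For `g x + g′ x * frac x` this primitive is explicit; for a
-- general tame function completeness supplies it, as a supremum of lower sums. In the final
-- identity only the finite sum over n is exchanged with the integral over x. Both sides then become
-- integrals over x of functions that agree pointwise on the interval, and uniqueness of the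
-- integral concludes.

module Proof (em : ExcludedMiddle 0ℓ) (R : CompleteOrderedField) where

  open Analysis em R
  open RingProperties ring
    using (-‿involutive; -‿+-comm; -0#≈0#; -‿distribˡ-*; -‿distribʳ-*)

  -- The embedding of ℤ in ℝ

  module _ where
    open Mult semiring using (×-homo-+; ×1-homo-*)
    open Mult′ semiring using (×ᵤ≈×) renaming (_×_ to _×′_)
    open SetoidReasoning setoid

    fromℤ-⊖ : ∀ m n → fromℤ (m ℤ.⊖ n) ≈ m · 1# - n · 1#
    fromℤ-⊖ m       zero    = sym (trans (+-congˡ -0#≈0#) (+-identityʳ _))
    fromℤ-⊖ zero    (suc n) = sym (+-identityˡ _)
    fromℤ-⊖ (suc m) (suc n) = begin
      fromℤ (suc m ℤ.⊖ suc n)      ≡⟨ ≡.cong fromℤ (ℤ.[1+m]⊖[1+n]≡m⊖n m n) ⟩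
      fromℤ (m ℤ.⊖ n)              ≈⟨ fromℤ-⊖ m n ⟩
      x - y                        ≈⟨ +-congʳ (trans (+-congʳ (-‿inverseʳ 1#)) (+-identityˡ x)) ⟨
      ((1# - 1#) + x) - y          ≈⟨ +-congʳ (trans (+-assoc _ _ _) (+-congˡ (+-comm _ _))) ⟩
      (1# + (x - 1#)) - y          ≈⟨ +-congʳ (+-assoc _ _ _) ⟨
      ((1# + x) - 1#) - y          ≈⟨ +-assoc _ _ _ ⟩
      (1# + x) + (- 1# - y)        ≈⟨ +-congˡ (-‿+-comm 1# y) ⟩
      (1# + x) - (1# + y)          ∎
      where
      x = m · 1#
      y = n · 1#

    fromℤ-+ : ∀ j k → fromℤ (j ℤ.+ k) ≈ fromℤ j + fromℤ k
    fromℤ-+ (+ m)    (+ n)    = ×-homo-+ 1# m n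
    fromℤ-+ (+ m)    -[1+ n ] = fromℤ-⊖ m (suc n)
    fromℤ-+ -[1+ m ] (+ n)    = trans (fromℤ-⊖ n (suc m)) (+-comm _ _)
    fromℤ-+ -[1+ m ] -[1+ n ] = begin
      - (1# + (1# + (m ℕ.+ n) · 1#))   ≈⟨ -‿cong (+-congˡ (×-homo-+ 1# (suc m) n)) ⟩
      - (1# + (suc m · 1# + n · 1#))   ≈⟨ -‿cong (trans (sym (+-assoc _ _ _))
                                            (trans (+-congʳ (+-comm _ _)) (+-assoc _ _ _))) ⟩
      - (suc m · 1# + suc n · 1#)      ≈⟨ -‿+-comm _ _ ⟨
      - (suc m · 1#) - suc n · 1#      ∎

    fromℤ-neg : ∀ k → fromℤ (ℤ.- k) ≈ - fromℤ k
    fromℤ-neg (+ zero)  = sym -0#≈0#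
    fromℤ-neg (+ suc n) = refl
    fromℤ-neg -[1+ n ]  = sym (-‿involutive _)

    fromℤ-pos-* : ∀ m k → fromℤ (+ m ℤ.* k) ≈ fromℤ (+ m) * fromℤ k
    fromℤ-pos-* m (+ n)    =
      trans (reflexive (≡.cong fromℤ (≡.sym (ℤ.pos-* m n)))) (×1-homo-* m n)
    fromℤ-pos-* m -[1+ n ] = begin
      fromℤ (+ m ℤ.* -[1+ n ])           ≡⟨ ≡.cong fromℤ (ℤ.neg-distribʳ-* (+ m) (+ suc n)) ⟨
      fromℤ (ℤ.- (+ m ℤ.* + suc n))      ≈⟨ fromℤ-neg (+ m ℤ.* + suc n) ⟩
      - fromℤ (+ m ℤ.* + suc n)          ≈⟨ -‿cong (fromℤ-pos-* m (+ suc n)) ⟩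
      - (fromℤ (+ m) * fromℤ (+ suc n))  ≈⟨ -‿distribʳ-* _ _ ⟩
      fromℤ (+ m) * - fromℤ (+ suc n)    ∎

    fromℤ-* : ∀ j k → fromℤ (j ℤ.* k) ≈ fromℤ j * fromℤ k
    fromℤ-* (+ m)    k = fromℤ-pos-* m k
    fromℤ-* -[1+ m ] k = begin
      fromℤ (-[1+ m ] ℤ.* k)         ≡⟨ ≡.cong fromℤ (ℤ.neg-distribˡ-* (+ suc m) k) ⟨
      fromℤ (ℤ.- (+ suc m ℤ.* k))    ≈⟨ fromℤ-neg (+ suc m ℤ.* k) ⟩
      - fromℤ (+ suc m ℤ.* k)        ≈⟨ -‿cong (fromℤ-pos-* (suc m) k) ⟩
      - (fromℤ (+ suc m) * fromℤ k)  ≈⟨ -‿distribˡ-* _ _ ⟩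
      - fromℤ (+ suc m) * fromℤ k    ∎

    -- Coefficients for the ring solver: fromℤ would make of the numeral 1 the
    -- term 1# + 0#, which does not match 1#.

    numeral : ℤ → ℝ
    numeral (+ n)    = n ×′ 1#
    numeral -[1+ n ] = - numeral (+ suc n)

    numeral≈fromℤ : ∀ k → numeral k ≈ fromℤ k
    numeral≈fromℤ (+ n)    = sym (×ᵤ≈× n 1#)
    numeral≈fromℤ -[1+ n ] = -‿cong (numeral≈fromℤ (+ suc n))

    numeral-via : ∀ j {x y} → fromℤ j ≈ x → x ≈ y → numeral j ≈ y
    numeral-via j p q = trans (numeral≈fromℤ j) (trans p q)

    numeral-homomorphism : ℤ.+-*-rawRing -Raw-AlmostCommutative⟶ fromCommutativeRing commutativeRing
    numeral-homomorphism = record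
      { ⟦_⟧    = numeral
      ; +-homo = λ j k → numeral-via (j ℤ.+ k) (fromℤ-+ j k)
                   (sym (+-cong (numeral≈fromℤ j) (numeral≈fromℤ k)))
      ; *-homo = λ j k → numeral-via (j ℤ.* k) (fromℤ-* j k)
                   (sym (*-cong (numeral≈fromℤ j) (numeral≈fromℤ k)))
      ; -‿homo = λ j → numeral-via (ℤ.- j) (fromℤ-neg j) (-‿cong (sym (numeral≈fromℤ j)))
      ; 0-homo = refl
      ; 1-homo = refl
      }

  open RingSolver _ _ numeral-homomorphism
    (λ j k → Maybe.map (λ j≡k → reflexive (≡.cong numeral j≡k)) (dec⇒maybe (j ℤ.≟ k)))
    using (solve; _:=_; _:+_; _:*_; _:-_; :-_; con)

  -- Inequalities in an ordered field

  open TotalOrder totalOrder using (antisym; total)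
    renaming (refl to ≤-refl; trans to ≤-trans; reflexive to ≤-reflexive)
  open Max totalOrder using (x≤y⇒x⊔y≈y; x≤y⇒y⊔x≈y)

  ≤-resp : ∀ {x x′ y y′} → x ≈ x′ → y ≈ y′ → x ≤ y → x′ ≤ y′
  ≤-resp p q x≤y = ≤-trans (≤-reflexive (sym p)) (≤-trans x≤y (≤-reflexive q))

  <-≤-trans : ∀ {x y z} → x < y → y ≤ z → x < z
  <-≤-trans = ToStrict.<-≤-trans _≈_ _≤_ sym ≤-trans antisym (≤-resp refl)

  ≤-<-trans : ∀ {x y z} → x ≤ y → y < z → x < z
  ≤-<-trans = ToStrict.≤-<-trans _≈_ _≤_ ≤-trans antisym (λ p → ≤-resp p refl)

  ≤-or-> : ∀ x y → x ≤ y ⊎ y < x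
  ≤-or-> x y with em {x ≤ y}
  ... | yes x≤y = inj₁ x≤y
  ... | no  x≰y = inj₂ (ToStrict.≰⇒> _≈_ _≤_ sym ≤-reflexive total x≰y)

  ≤⇒0≤ : ∀ {x y} → x ≤ y → 0# ≤ y - x
  ≤⇒0≤ {x} x≤y = ≤-resp (-‿inverseʳ x) refl (+-monoˡ-≤ (- x) x≤y)

  -- The working form of nearly all inequalities below: the difference of the two sides is exhibited
  -- as a visibly nonnegative expression, and the equation is left to the ring solver.
  ≤-by : ∀ {x y e} → 0# ≤ e → y - x ≈ e → x ≤ y
  ≤-by {x} {y} {e} 0≤e p = ≤-resp (+-identityˡ x)
    (trans (+-congʳ (sym p)) (solve 2 (λ x y → y :- x :+ x := y) refl x y))
    (+-monoˡ-≤ x 0≤e)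

  +-nonNeg : ∀ {x y} → 0# ≤ x → 0# ≤ y → 0# ≤ x + y
  +-nonNeg {x} {y} 0≤x 0≤y =
    ≤-trans 0≤y (≤-resp (+-identityˡ y) refl (+-monoˡ-≤ y 0≤x))

  halve-nonNeg : ∀ {x} → 0# ≤ x + x → 0# ≤ x
  halve-nonNeg {x} 0≤x+x with total 0# x
  ... | inj₁ 0≤x = 0≤x
  ... | inj₂ x≤0 = ≤-trans 0≤x+x (≤-resp refl (+-identityˡ x) (+-monoˡ-≤ x x≤0))

  +-mono-≤ : ∀ {x y u v} → x ≤ y → u ≤ v → x + u ≤ y + v
  +-mono-≤ {x} {y} {u} {v} x≤y u≤v = ≤-by (+-nonNeg (≤⇒0≤ x≤y) (≤⇒0≤ u≤v))
    (solve 4 (λ x y u v → (y :+ v) :- (x :+ u) := (y :- x) :+ (v :- u)) refl x y u v)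

  *-monoʳ-≤ : ∀ {x y z} → 0# ≤ z → x ≤ y → x * z ≤ y * z
  *-monoʳ-≤ {x} {y} {z} 0≤z x≤y = ≤-by (*-nonNeg (≤⇒0≤ x≤y) 0≤z)
    (solve 3 (λ x y z → y :* z :- x :* z := (y :- x) :* z) refl x y z)

  *-monoˡ-≤ : ∀ {x y z} → 0# ≤ z → x ≤ y → z * x ≤ z * y
  *-monoˡ-≤ 0≤z x≤y = ≤-resp (*-comm _ _) (*-comm _ _) (*-monoʳ-≤ 0≤z x≤y)

  0≤1 : 0# ≤ 1#
  0≤1 with total 0# 1#
  ... | inj₁ 0≤1 = 0≤1
  ... | inj₂ 1≤0 = ≤-resp refl
    (solve 0 ((con (+ 0) :- con (+ 1)) :* (con (+ 0) :- con (+ 1)) := con (+ 1)) refl)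
    (*-nonNeg (≤⇒0≤ 1≤0) (≤⇒0≤ 1≤0))

  0<1 : 0# < 1#
  0<1 = 0≤1 , 0≉1

  <⇒≱ : ∀ {x y} → x < y → ¬ (y ≤ x)
  <⇒≱ = ToStrict.<⇒≱ _≈_ _≤_ antisym

  x≤x+y : ∀ {x y} → 0# ≤ y → x ≤ x + y
  x≤x+y {x} {y} 0≤y = ≤-by 0≤y (solve 2 (λ x y → (x :+ y) :- x := y) refl x y)

  -- Absolute values

  -- Splits a bound on an absolute value into two nonnegative quantities, so that the rules below
  -- become ring identities. `∣∣-upper` and `∣∣-lower` are the converses.
  ∣∣-by : ∀ {x m} → 0# ≤ m - x → 0# ≤ m + x → ∣ x ∣ ≤ m
  ∣∣-by {x} {m} p q with total x (- x)
  ... | inj₁ x≤-x = ≤-resp (sym (x≤y⇒x⊔y≈y x≤-x)) refl (≤-by q (+-congˡ (-‿involutive x)))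
  ... | inj₂ -x≤x = ≤-resp (sym (x≤y⇒y⊔x≈y -x≤x)) refl (≤-by p refl)

  x≤∣x∣ : ∀ x → x ≤ ∣ x ∣
  x≤∣x∣ x with total x (- x)
  ... | inj₁ x≤-x = ≤-resp refl (sym (x≤y⇒x⊔y≈y x≤-x)) x≤-x
  ... | inj₂ -x≤x = ≤-reflexive (sym (x≤y⇒y⊔x≈y -x≤x))

  -x≤∣x∣ : ∀ x → - x ≤ ∣ x ∣
  -x≤∣x∣ x with total x (- x)
  ... | inj₁ x≤-x = ≤-reflexive (sym (x≤y⇒x⊔y≈y x≤-x))
  ... | inj₂ -x≤x = ≤-resp refl (sym (x≤y⇒y⊔x≈y -x≤x)) -x≤x

  ∣∣-upper : ∀ {x m} → ∣ x ∣ ≤ m → 0# ≤ m - x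
  ∣∣-upper {x} h = ≤⇒0≤ (≤-trans (x≤∣x∣ x) h)

  ∣∣-lower : ∀ {x m} → ∣ x ∣ ≤ m → 0# ≤ m + x
  ∣∣-lower {x} h = ≤-resp refl (+-congˡ (-‿involutive x)) (≤⇒0≤ (≤-trans (-x≤∣x∣ x) h))

  ∣∣-bound-nonNeg : ∀ {x m} → ∣ x ∣ ≤ m → 0# ≤ m
  ∣∣-bound-nonNeg {x} {m} h = halve-nonNeg (≤-resp refl
    (solve 2 (λ x m → (m :- x) :+ (m :+ x) := m :+ m) refl x m)
    (+-nonNeg (∣∣-upper h) (∣∣-lower h)))

  0≤∣x∣ : ∀ x → 0# ≤ ∣ x ∣
  0≤∣x∣ x = ∣∣-bound-nonNeg {x} ≤-refl

  ∣∣-resp : ∀ {x y m n} → x ≈ y → m ≤ n → ∣ x ∣ ≤ m → ∣ y ∣ ≤ n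
  ∣∣-resp x≈y m≤n h = ∣∣-by
    (≤-trans (∣∣-upper h) (+-mono-≤ m≤n (≤-reflexive (-‿cong x≈y))))
    (≤-trans (∣∣-lower h) (+-mono-≤ m≤n (≤-reflexive x≈y)))

  ∣∣-+ : ∀ {x y m n} → ∣ x ∣ ≤ m → ∣ y ∣ ≤ n → ∣ x + y ∣ ≤ m + n
  ∣∣-+ {x} {y} {m} {n} h k = ∣∣-by
    (≤-resp refl (solve 4 (λ x y m n → (m :- x) :+ (n :- y) := (m :+ n) :- (x :+ y)) refl x y m n)
      (+-nonNeg (∣∣-upper h) (∣∣-upper k)))
    (≤-resp refl (solve 4 (λ x y m n → (m :+ x) :+ (n :+ y) := (m :+ n) :+ (x :+ y)) refl x y m n)
      (+-nonNeg (∣∣-lower h) (∣∣-lower k)))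

  -- Twice `m * n - x * y` is `(m - x) * (n + y) + (m + x) * (n - y)`, a sum of products of
  -- nonnegative factors; changing the sign of `y` gives the other half.
  ∣∣-* : ∀ {x y m n} → ∣ x ∣ ≤ m → ∣ y ∣ ≤ n → ∣ x * y ∣ ≤ m * n
  ∣∣-* {x} {y} {m} {n} h k = ∣∣-by
    (halve-nonNeg (≤-resp refl
      (solve 4 (λ x y m n → (m :- x) :* (n :+ y) :+ (m :+ x) :* (n :- y) :=
                            (m :* n :- x :* y) :+ (m :* n :- x :* y)) refl x y m n)
      (+-nonNeg (*-nonNeg (∣∣-upper h) (∣∣-lower k)) (*-nonNeg (∣∣-lower h) (∣∣-upper k)))))
    (halve-nonNeg (≤-resp refl
      (solve 4 (λ x y m n → (m :- x) :* (n :- y) :+ (m :+ x) :* (n :+ y) :=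
                            (m :* n :+ x :* y) :+ (m :* n :+ x :* y)) refl x y m n)
      (+-nonNeg (*-nonNeg (∣∣-upper h) (∣∣-upper k)) (*-nonNeg (∣∣-lower h) (∣∣-lower k)))))

  ∣∣-neg : ∀ {x m} → ∣ x ∣ ≤ m → ∣ - x ∣ ≤ m
  ∣∣-neg {x} h = ∣∣-by (≤-resp refl (+-congˡ (sym (-‿involutive x))) (∣∣-lower h)) (∣∣-upper h)

  ∣∣-sym : ∀ {x y m} → ∣ x - y ∣ ≤ m → ∣ y - x ∣ ≤ m
  ∣∣-sym {x} {y} h = ∣∣-resp (solve 2 (λ x y → :- (x :- y) := y :- x) refl x y) ≤-refl (∣∣-neg h)

  ∣∣-nonNeg : ∀ {x m} → 0# ≤ x → x ≤ m → ∣ x ∣ ≤ m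
  ∣∣-nonNeg 0≤x x≤m = ∣∣-by (≤⇒0≤ x≤m) (+-nonNeg (≤-trans 0≤x x≤m) 0≤x)

  ∣∣-zero : ∀ {x m} → x ≈ 0# → 0# ≤ m → ∣ x ∣ ≤ m
  ∣∣-zero x≈0 0≤m = ∣∣-nonNeg (≤-reflexive (sym x≈0)) (≤-resp (sym x≈0) refl 0≤m)

  ∣∣-triangle : ∀ {x y z m n} → ∣ x - y ∣ ≤ m → ∣ y - z ∣ ≤ n → ∣ x - z ∣ ≤ m + n
  ∣∣-triangle {x} {y} {z} h k = ∣∣-resp
    (solve 3 (λ x y z → (x :- y) :+ (y :- z) := x :- z) refl x y z) ≤-refl (∣∣-+ h k)

  ∣x-y∣≤0⇒x≈y : ∀ {x y} → ∣ x - y ∣ ≤ 0# → x ≈ y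
  ∣x-y∣≤0⇒x≈y {x} {y} h = antisym
    (≤-by (∣∣-upper h) (solve 2 (λ x y → y :- x := con (+ 0) :- (x :- y)) refl x y))
    (≤-by (∣∣-lower h) (solve 2 (λ x y → x :- y := con (+ 0) :+ (x :- y)) refl x y))

  ∈-distance : ∀ {p q s t} → s ∈[ p , q ] → t ∈[ p , q ] → ∣ s - t ∣ ≤ q - p
  ∈-distance {p} {q} {s} {t} (p≤s , s≤q) (p≤t , t≤q) = ∣∣-by
    (≤-resp refl (solve 4 (λ p q s t → (q :- s) :+ (t :- p) := (q :- p) :- (s :- t)) refl p q s t)
      (+-nonNeg (≤⇒0≤ s≤q) (≤⇒0≤ p≤t)))
    (≤-resp refl (solve 4 (λ p q s t → (q :- t) :+ (s :- p) := (q :- p) :+ (s :- t)) refl p q s t)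
      (+-nonNeg (≤⇒0≤ t≤q) (≤⇒0≤ p≤s)))

  -- Choosing small numbers

  Positive : ℝ → Set
  Positive x = 0# < x

  common : ∀ {δ₁ δ₂} → Positive δ₁ → Positive δ₂ → ∃[ δ ] (Positive δ × δ ≤ δ₁ × δ ≤ δ₂)
  common {δ₁} {δ₂} p q with total δ₁ δ₂
  ... | inj₁ δ₁≤δ₂ = δ₁ , p , ≤-refl , δ₁≤δ₂
  ... | inj₂ δ₂≤δ₁ = δ₂ , q , δ₂≤δ₁ , ≤-refl

  -- Stands in for division by a constant of unknown sign: `η` itself serves when `L ≤ 1`, including
  -- negative `L`, and `η / L` serves otherwise.
  shrink : ∀ {η} → Positive η → ∀ L → ∃[ ε ] (Positive ε × ε * L ≤ η)
  shrink {η} (0≤η , 0≉η) L with total L 1#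
  ... | inj₁ L≤1 = η , (0≤η , 0≉η) , ≤-resp refl (*-identityʳ η) (*-monoˡ-≤ 0≤η L≤1)
  ... | inj₂ 1≤L =
    η * y , (*-nonNeg 0≤η 0≤y , λ 0≈ηy → 0≉η (trans (sym (zeroˡ L)) (trans (*-congʳ 0≈ηy) ηyL≈η))) ,
    ≤-reflexive ηyL≈η
    where
    y : ℝ
    y = proj₁ (inverse L λ L≈0 → <⇒≱ 0<1 (≤-resp refl L≈0 1≤L))
    Ly≈1 : L * y ≈ 1#
    Ly≈1 = proj₂ (inverse L λ L≈0 → <⇒≱ 0<1 (≤-resp refl L≈0 1≤L))
    ηyL≈η : η * y * L ≈ η
    ηyL≈η = trans (solve 3 (λ η y L → η :* y :* L := η :* (L :* y)) refl η y L)
                  (trans (*-congˡ Ly≈1) (*-identityʳ η))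
    0≤y : 0# ≤ y
    0≤y with total 0# y
    ... | inj₁ 0≤y = 0≤y
    ... | inj₂ y≤0 = ⊥-elim (<⇒≱ 0<1 (≤-by (*-nonNeg (≤-trans 0≤1 1≤L) (≤⇒0≤ y≤0))
      (trans (+-congˡ (-‿cong (sym Ly≈1)))
        (solve 2 (λ L y → con (+ 0) :- L :* y := L :* (con (+ 0) :- y)) refl L y))))

  x<x+ε : ∀ {x ε} → Positive ε → x < x + ε
  x<x+ε {x} {ε} (0≤ε , 0≉ε) = x≤x+y 0≤ε , λ x≈x+ε → 0≉ε (trans (sym (-‿inverseʳ x))
    (trans (+-congʳ x≈x+ε) (solve 2 (λ x ε → (x :+ ε) :- x := ε) refl x ε)))

  half : ∀ {η} → Positive η → ∃[ ε ] (Positive ε × ε + ε < η)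
  half p =
    -- A third of `η` leaves room to spare: non-strict bounds by `ε + ε` then yield strict bounds by
    -- `η`.
    let ε , 0<ε , 3ε≤η = shrink p (1# + 1# + 1#)
    in ε , 0<ε , <-≤-trans (x<x+ε 0<ε)
         (≤-resp (solve 1 (λ ε → ε :* con (+ 3) := (ε :+ ε) :+ ε) refl ε) refl 3ε≤η)

  <⇒0< : ∀ {x y} → x < y → Positive (y - x)
  <⇒0< {x} {y} (x≤y , x≉y) = ≤⇒0≤ x≤y , λ 0≈y-x → x≉y (trans (sym (+-identityˡ x))
    (trans (+-congʳ 0≈y-x) (solve 2 (λ x y → (y :- x) :+ x := y) refl x y)))

  ≤-limit : ∀ {x y} → (∀ ε → Positive ε → x ≤ y + ε) → x ≤ y
  ≤-limit {x} {y} h with ≤-or-> x y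
  ... | inj₁ x≤y = x≤y
  ... | inj₂ y<x = let ε , 0<ε , ε+ε<x-y = half (<⇒0< y<x) in ⊥-elim (<⇒≱ (x<x+ε 0<ε)
    (≤-by (+-nonNeg (≤⇒0≤ (h ε 0<ε)) (≤⇒0≤ (proj₁ ε+ε<x-y)))
      (solve 3 (λ x y ε → ε :- (ε :+ ε) := ((y :+ ε) :- x) :+ ((x :- y) :- (ε :+ ε))) refl x y ε)))

  -- Local and additive properties of intervals hold globally: if s is the
  -- supremum of the v ≤ b with Q a v, then Q a (s + ε) for some ε > 0 unless
  -- s + ε exceeds b.

  interval-induction :
    ∀ {a b} → a ≤ b → (Q : ℝ → ℝ → Set) →
    (∀ {u v w} → u ≤ v → v ≤ w → Q u v → Q v w → Q u w) →
    (∀ x → x ∈[ a , b ] → ∃[ δ ] (Positive δ ×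
      (∀ {u v} → a ≤ u → u ≤ x → x ≤ v → v ≤ b → v - u < δ → Q u v))) →
    Q a b
  interval-induction {a} {b} a≤b Q additive local = reaches (≤-or-> (s + ε) b)
    where
    S : ℝ → Set
    S v = v ∈[ a , b ] × Q a v

    a∈S : S a
    a∈S = let δ , 0<δ , near = local a (≤-refl , a≤b) in
      (≤-refl , a≤b) ,
      near ≤-refl ≤-refl ≤-refl a≤b (≤-<-trans (≤-reflexive (-‿inverseʳ a)) 0<δ)

    sup : ∃ (IsSupremum S)
    sup = supremum S (a , a∈S) (b , λ _ z∈S → proj₂ (proj₁ z∈S))

    s : ℝ
    s = proj₁ sup

    ≤s : IsUpperBound S s
    ≤s = proj₁ (proj₂ sup)

    s∈ : s ∈[ a , b ]
    s∈ = ≤s a a∈S , proj₂ (proj₂ sup) b (λ _ z∈S → proj₂ (proj₁ z∈S))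

    δ-near = local s s∈
    δ = proj₁ δ-near
    ε-half = half (proj₁ (proj₂ δ-near))
    ε = proj₁ ε-half

    0<ε : Positive ε
    0<ε = proj₁ (proj₂ ε-half)

    close : ∃[ v ] (S v × s - ε ≤ v)
    close with em {∃[ v ] (S v × s - ε ≤ v)}
    ... | yes p = p
    ... | no ¬p = ⊥-elim (<⇒≱ (x<x+ε 0<ε)
      (≤-by (≤⇒0≤ (proj₂ (proj₂ sup) (s - ε) below))
        (solve 2 (λ s ε → s :- (s :+ ε) := (s :- ε) :- s) refl s ε)))
      where
      below : IsUpperBound S (s - ε)
      below z z∈S with ≤-or-> z (s - ε)
      ... | inj₁ z≤s-ε = z≤s-ε
      ... | inj₂ s-ε<z = ⊥-elim (¬p (z , z∈S , proj₁ s-ε<z))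

    extend : ∀ w → s ≤ w → w ≤ b → w ≤ s + ε → S w
    extend w s≤w w≤b w≤s+ε =
      let v , (v∈ , Qav) , s-ε≤v = close
          v≤s = ≤s v (v∈ , Qav)
          narrow = ≤-<-trans
            (≤-by (+-nonNeg (≤⇒0≤ w≤s+ε) (≤⇒0≤ s-ε≤v))
              (solve 4 (λ s ε v w → (ε :+ ε) :- (w :- v) := ((s :+ ε) :- w) :+ (v :- (s :- ε)))
                  refl s ε v w))
            (proj₂ (proj₂ ε-half))
      in (≤-trans (proj₁ s∈) s≤w , w≤b) ,
         additive (proj₁ v∈) (≤-trans v≤s s≤w) Qav
           (proj₂ (proj₂ δ-near) (proj₁ v∈) v≤s s≤w w≤b narrow)

    reaches : s + ε ≤ b ⊎ b < s + ε → Q a b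
    reaches (inj₁ s+ε≤b) = ⊥-elim (<⇒≱ (x<x+ε 0<ε)
      (≤s (s + ε) (extend (s + ε) (x≤x+y (proj₁ 0<ε)) s+ε≤b ≤-refl)))
    reaches (inj₂ b<s+ε) = proj₂ (extend b (proj₂ s∈) ≤-refl (proj₁ b<s+ε))

  -- Compactness and the mean value inequality

  Directed : {K A : Set} → (K → A → Set) → Set
  Directed E = ∀ k l → ∃[ m ] ((∀ {x} → E k x → E m x) × (∀ {x} → E l x → E m x))

  compactness :
    ∀ {a b} → a ≤ b → {K : Set} (E : K → ℝ → Set) → Directed E →
    (∀ x → x ∈[ a , b ] → ∃[ k ] ∃[ δ ] (Positive δ ×
      (∀ s → s ∈[ a , b ] → ∣ s - x ∣ < δ → E k s))) →
    ∃[ k ] (∀ s → s ∈[ a , b ] → E k s)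
  compactness {a} {b} a≤b E join local = interval-induction a≤b
    (λ u v → ∃[ k ] (∀ s → s ∈[ u , v ] → E k s))
    (λ {u} {v} {w} _ _ (k , Ek) (l , El) → let m , k⇒m , l⇒m = join k l in
      m , λ s (u≤s , s≤w) → [ (λ s≤v → k⇒m (Ek s (u≤s , s≤v)))
                            , (λ v≤s → l⇒m (El s (v≤s , s≤w))) ]′ (total s v))
    λ x x∈ → let k , δ , 0<δ , near = local x x∈ in
      δ , 0<δ , λ a≤u u≤x x≤v v≤b v-u<δ → k , λ s (u≤s , s≤v) →
        near s (≤-trans a≤u u≤s , ≤-trans s≤v v≤b)
          (≤-<-trans (∈-distance (u≤s , s≤v) (u≤x , x≤v)) v-u<δ)

  -- The tube lemma: compactness in y at a fixed x yields an index valid on a whole strip around x,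
  -- and compactness in x then joins the strips.
  compactness₂ :
    ∀ {a b c d} → a ≤ b → c ≤ d → {K : Set} (E : K → ℝ × ℝ → Set) → Directed E →
    (∀ x y → x ∈[ a , b ] → y ∈[ c , d ] → ∃[ k ] ∃[ δ ] (Positive δ ×
      (∀ s t → s ∈[ a , b ] → t ∈[ c , d ] → ∣ s - x ∣ < δ → ∣ t - y ∣ < δ → E k (s , t)))) →
    ∃[ k ] (∀ s t → s ∈[ a , b ] → t ∈[ c , d ] → E k (s , t))
  compactness₂ {a} {b} {c} {d} a≤b c≤d {K} E join local =
    let k , Ek = compactness a≤b
                   (λ k s → ∀ t → t ∈[ c , d ] → E k (s , t))
                   (λ k l → let m , k⇒m , l⇒m = join k l in
                     m , (λ Ek t t∈ → k⇒m (Ek t t∈)) , (λ El t t∈ → l⇒m (El t t∈)))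
                   strip
    in k , λ s t s∈ → Ek s s∈ t
    where
    strip : ∀ x → x ∈[ a , b ] → ∃[ k ] ∃[ δ ] (Positive δ ×
      (∀ s → s ∈[ a , b ] → ∣ s - x ∣ < δ → ∀ t → t ∈[ c , d ] → E k (s , t)))
    strip x x∈ =
      -- The index also carries the half-width of the strip, so that one positive width survives for
      -- all t at once.
      let (k , δ , 0<δ) , Ek = compactness c≤d {K × ∃ Positive}
            (λ (k , δ , _) t → ∀ s → s ∈[ a , b ] → ∣ s - x ∣ < δ → E k (s , t))
            (λ (k , _ , 0<δ₁) (l , _ , 0<δ₂) →
              let m , k⇒m , l⇒m = join k l
                  δ , 0<δ , δ≤δ₁ , δ≤δ₂ = common 0<δ₁ 0<δ₂
              in (m , δ , 0<δ) ,
                 (λ Ek s s∈ near → k⇒m (Ek s s∈ (<-≤-trans near δ≤δ₁))) ,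
                 (λ El s s∈ near → l⇒m (El s s∈ (<-≤-trans near δ≤δ₂))))
            λ y y∈ → let k , δ , 0<δ , near = local x y x∈ y∈ in
              (k , δ , 0<δ) , δ , 0<δ , λ t t∈ t-near s s∈ s-near → near s t s∈ t∈ s-near t-near
      in k , δ , 0<δ , λ s s∈ s-near t t∈ → Ek t t∈ s s∈ s-near

  -- The inequality is additive in the interval, so interval induction reduces it to short intervals
  -- around a point x, where differentiability at x compares both ends with x. The error `θ` of that
  -- comparison is removed by a limit. The slope `c` is left free: it is the derivative at a tag in
  -- the summation formula, and zero in `increment-≤`.
  mean-value :
    ∀ {a b} (g g′ : ℝ → ℝ) → (∀ x → x ∈[ a , b ] → HasDerivativeAt a b g (g′ x) x) →
    ∀ {p q c ε} → a ≤ p → p ≤ q → q ≤ b →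
    (∀ x → x ∈[ p , q ] → ∣ g′ x - c ∣ ≤ ε) →
    ∣ (g q - g p) - c * (q - p) ∣ ≤ ε * (q - p)
  mean-value {a} {b} g g′ derivative {p} {q} {c} {ε} a≤p p≤q q≤b g′-near-c =
    ≤-limit λ η 0<η →
      let θ , 0<θ , θL≤η = shrink 0<η (q - p) in
      ∣∣-resp refl (≤-by (≤⇒0≤ θL≤η)
          (solve 4 (λ ε θ η L → (ε :* L :+ η) :- (ε :+ θ) :* L := η :- θ :* L) refl ε θ η (q - p)))
        (bound θ 0<θ)
    where
    bound : ∀ θ → Positive θ → ∣ (g q - g p) - c * (q - p) ∣ ≤ (ε + θ) * (q - p)
    bound θ 0<θ = interval-induction p≤q
      (λ u v → ∣ (g v - g u) - c * (v - u) ∣ ≤ (ε + θ) * (v - u))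
      (λ {u} {v} {w} _ _ h k → ∣∣-resp
        (solve 7 (λ gu gv gw c u v w →
          ((gv :- gu) :- c :* (v :- u)) :+ ((gw :- gv) :- c :* (w :- v)) :=
          (gw :- gu) :- c :* (w :- u)) refl (g u) (g v) (g w) c u v w)
        (≤-reflexive (solve 4 (λ e u v w → e :* (v :- u) :+ e :* (w :- v) := e :* (w :- u))
            refl (ε + θ) u v w))
        (∣∣-+ h k))
      λ x x∈ →
        let a≤x = ≤-trans a≤p (proj₁ x∈)
            x≤b = ≤-trans (proj₂ x∈) q≤b
            δ , 0<δ , near = derivative x (a≤x , x≤b) θ 0<θ
        in δ , 0<δ , λ {u} {v} p≤u u≤x x≤v v≤q v-u<δ →
          let u≤v = ≤-trans u≤x x≤v
              right = near v (≤-trans a≤x x≤v , ≤-trans v≤q q≤b)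
                (≤-<-trans (∈-distance (u≤v , ≤-refl) (u≤x , x≤v)) v-u<δ)
              left = near u (≤-trans a≤p p≤u , ≤-trans u≤x x≤b)
                (≤-<-trans (∈-distance (≤-refl , u≤v) (u≤x , x≤v)) v-u<δ)
              right′ = ≤-trans right (*-monoˡ-≤ (proj₁ 0<θ)
                (∈-distance (x≤v , ≤-refl) (≤-refl , x≤v)))
              left′ = ≤-trans left (*-monoˡ-≤ (proj₁ 0<θ)
                (∈-distance (≤-refl , u≤x) (u≤x , ≤-refl)))
          in ∣∣-resp
            (solve 8 (λ gu gx gv g′ c u x v →
              (((gv :- gx) :- g′ :* (v :- x)) :+ (:- ((gu :- gx) :- g′ :* (u :- x)))) :+ (g′ :- c) :* (v :- u)
              := (gv :- gu) :- c :* (v :- u)) refl (g u) (g x) (g v) (g′ x) c u x v)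
            (≤-reflexive (solve 5 (λ ε θ u x v →
              ((θ :* (v :- x)) :+ (θ :* (x :- u))) :+ ε :* (v :- u) := (ε :+ θ) :* (v :- u))
                  refl ε θ u x v))
            (∣∣-+ (∣∣-+ right′ (∣∣-neg left′))
              (∣∣-* (g′-near-c x x∈) (∣∣-nonNeg (≤⇒0≤ u≤v) ≤-refl)))

  -- Partitions grow at their left end, so the inductive property is the ability to prefix [u,v] to
  -- any fine partition starting at v. Additivity is then mere composition, and the empty partition
  -- at b starts the construction.
  fine-partition : ∀ {a b δ} → a ≤ b → Positive δ → ∃[ P ] (FinerThan {a} {b} δ P)
  fine-partition {a} {b} {δ} a≤b 0<δ = interval-induction a≤b
    (λ u v → ∀ {w} → ∃ (FinerThan {v} {w} δ) → ∃ (FinerThan {u} {w} δ))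
    (λ _ _ uv vw z → uv (vw z))
    (λ x _ → δ , 0<δ , λ {u} {v} _ u≤x x≤v _ v-u<δ (P , fine) →
      cons x v (u≤x , x≤v) P , v-u<δ , fine)
    (nil refl , tt)

  -- Integral and fractional parts

  fromℤ-nonNeg : ∀ n → 0# ≤ fromℤ (+ n)
  fromℤ-nonNeg zero    = ≤-refl
  fromℤ-nonNeg (suc n) = +-nonNeg 0≤1 (fromℤ-nonNeg n)

  fromℤ-mono : ∀ {j k} → j ℤ.≤ k → fromℤ j ≤ fromℤ k
  fromℤ-mono {j} {k} j≤k = ≤-by (fromℤ-nonNeg ℤ.∣ k ℤ.- j ∣)
    (sym (trans (reflexive (≡.cong fromℤ (ℤ.0≤i⇒+∣i∣≡i (ℤ.i≤j⇒0≤j-i j≤k))))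
      (trans (fromℤ-+ k (ℤ.- j)) (+-congˡ (fromℤ-neg j)))))

  fromℤ-suc : ∀ k → fromℤ (ℤ.suc k) ≈ fromℤ k + 1#
  fromℤ-suc k = trans (fromℤ-+ (+ 1) k) (trans (+-comm _ _) (+-congˡ (+-identityʳ 1#)))

  fromℤ<suc⇒≤ : ∀ {j k} → fromℤ j < fromℤ k + 1# → j ℤ.≤ k
  fromℤ<suc⇒≤ {j} {k} j<k+1 = ℤ.≮⇒≥ λ k<j →
    <⇒≱ j<k+1 (≤-resp (fromℤ-suc k) refl (fromℤ-mono (ℤ.i<j⇒suc[i]≤j k<j)))

  ⌊⌋≤ : ∀ x → fromℤ ⌊ x ⌋ ≤ x
  ⌊⌋≤ x = proj₁ (proj₂ (floor x))

  <⌊⌋+1 : ∀ x → x < fromℤ ⌊ x ⌋ + 1#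
  <⌊⌋+1 x = proj₂ (proj₂ (floor x))

  ⌊⌋-mono : ∀ {x y} → x ≤ y → ⌊ x ⌋ ℤ.≤ ⌊ y ⌋
  ⌊⌋-mono {x} {y} x≤y = fromℤ<suc⇒≤ (≤-<-trans (≤-trans (⌊⌋≤ x) x≤y) (<⌊⌋+1 y))

  ⌊fromℤ⌋ : ∀ k → ⌊ fromℤ k ⌋ ≡ k
  ⌊fromℤ⌋ k = ℤ.≤-antisym
    (fromℤ<suc⇒≤ (≤-<-trans (⌊⌋≤ (fromℤ k)) (x<x+ε 0<1)))
    (fromℤ<suc⇒≤ (<⌊⌋+1 (fromℤ k)))

  ⌊⌋-step : ∀ {p q} → p ≤ q → q - p < 1# → ⌊ p ⌋ ≡ ⌊ q ⌋ ⊎ ℤ.suc ⌊ p ⌋ ≡ ⌊ q ⌋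
  ⌊⌋-step {p} {q} p≤q q-p<1 with ⌊ p ⌋ ℤ.≟ ⌊ q ⌋
  ... | yes p≡q = inj₁ p≡q
  ... | no  p≢q = inj₂ (ℤ.≤-antisym
    (ℤ.i<j⇒suc[i]≤j (ℤ.≤∧≢⇒< (⌊⌋-mono p≤q) p≢q))
    (fromℤ<suc⇒≤ (≤-<-trans (⌊⌋≤ q) (≤-<-trans
      (≤-by (≤⇒0≤ (proj₁ q-p<1)) (solve 2 (λ p q → (p :+ con (+ 1)) :- q := con (+ 1) :- (q :- p))
          refl p q))
      (<⇒+1<suc+1 (<⌊⌋+1 p))))))
    where
    <⇒+1<suc+1 : p < fromℤ ⌊ p ⌋ + 1# → p + 1# < fromℤ (ℤ.suc ⌊ p ⌋) + 1#
    <⇒+1<suc+1 (p≤ , p≉) = +-mono-≤ (≤-resp refl (sym (fromℤ-suc ⌊ p ⌋)) p≤) ≤-refl ,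
      λ eq → p≉ (trans (solve 1 (λ p → p := (p :+ con (+ 1)) :- con (+ 1)) refl p)
        (trans (+-congʳ (trans eq (+-congʳ (fromℤ-suc ⌊ p ⌋))))
          (solve 1 (λ k → ((k :+ con (+ 1)) :+ con (+ 1)) :- con (+ 1) := k :+ con (+ 1))
              refl (fromℤ ⌊ p ⌋))))

  frac : ℝ → ℝ
  frac x = x - fromℤ ⌊ x ⌋

  0≤frac : ∀ x → 0# ≤ frac x
  0≤frac x = ≤⇒0≤ (⌊⌋≤ x)

  frac≤1 : ∀ x → frac x ≤ 1#
  frac≤1 x = ≤-by (≤⇒0≤ (proj₁ (<⌊⌋+1 x)))
    (solve 2 (λ x k → con (+ 1) :- (x :- k) := (k :+ con (+ 1)) :- x) refl x (fromℤ ⌊ x ⌋))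

  ∣frac∣≤1 : ∀ x → ∣ frac x ∣ ≤ 1#
  ∣frac∣≤1 x = ∣∣-nonNeg (0≤frac x) (frac≤1 x)

  -- Riemann sums

  partition-≤ : ∀ {a b} → TaggedPartition a b → a ≤ b
  partition-≤ (nil a≈b)              = ≤-reflexive a≈b
  partition-≤ (cons t p (a≤t , t≤p) P) = ≤-trans a≤t (≤-trans t≤p (partition-≤ P))

  FinerThan-mono : ∀ {a b δ δ′} → δ ≤ δ′ → (P : TaggedPartition a b) → FinerThan δ P → FinerThan δ′ P
  FinerThan-mono δ≤δ′ (nil _)        _          = tt
  FinerThan-mono δ≤δ′ (cons _ _ _ P) (h , fine) = <-≤-trans h δ≤δ′ , FinerThan-mono δ≤δ′ P fine

  Error : (u Φ : ℝ → ℝ) (p t q : ℝ) → ℝ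
  Error u Φ p t q = u t * (q - p) - (Φ q - Φ p)

  -- A step with p ≈ q covers the case of an empty partition, so neither Φ nor
  -- Ψ need respect _≈_.

  telescope :
    ∀ {a b δ} {u Φ Ψ : ℝ → ℝ} → Positive δ →
    (∀ {p t q} → a ≤ p → t ∈[ p , q ] → q ≤ b → q - p < δ →
      ∣ Error u Φ p t q ∣ ≤ Ψ q - Ψ p) →
    (P : TaggedPartition a b) → FinerThan δ P →
    ∣ riemannSum u P - (Φ b - Φ a) ∣ ≤ Ψ b - Ψ a
  telescope {a} {b} {δ} {u} {Φ} 0<δ step (nil a≈b) _ = ∣∣-resp
    (+-congʳ (trans (*-congˡ b-a≈0) (zeroʳ (u a)))) ≤-refl
    (step ≤-refl (≤-refl , ≤-reflexive a≈b) ≤-refl (≤-<-trans (≤-reflexive b-a≈0) 0<δ))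
    where
    b-a≈0 : b - a ≈ 0#
    b-a≈0 = trans (+-congˡ (-‿cong a≈b)) (-‿inverseʳ b)
  telescope {a} {b} {δ} {u} {Φ} {Ψ} 0<δ step (cons t p t∈ P) (p-a<δ , fine) = ∣∣-resp
    (solve 5 (λ e r Φa Φp Φb → (e :- (Φp :- Φa)) :+ (r :- (Φb :- Φp)) := (e :+ r) :- (Φb :- Φa))
      refl (u t * (p - a)) (riemannSum u P) (Φ a) (Φ p) (Φ b))
    (≤-reflexive (solve 3 (λ Ψa Ψp Ψb → (Ψp :- Ψa) :+ (Ψb :- Ψp) := Ψb :- Ψa)
        refl (Ψ a) (Ψ p) (Ψ b)))
    (∣∣-+ (step ≤-refl t∈ (partition-≤ P) p-a<δ)
      (telescope 0<δ (λ p≤p′ → step (≤-trans (≤-trans (proj₁ t∈) (proj₂ t∈)) p≤p′)) P fine))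

  riemannSum-close :
    ∀ {a b η} {u v : ℝ → ℝ} → (∀ x → x ∈[ a , b ] → ∣ u x - v x ∣ ≤ η) →
    (P : TaggedPartition a b) → ∣ riemannSum u P - riemannSum v P ∣ ≤ η * (b - a)
  riemannSum-close {a} {b} {η} u≈v (nil a≈b) = ∣∣-zero (-‿inverseʳ 0#)
    (≤-reflexive (sym (trans (*-congˡ (trans (+-congˡ (-‿cong a≈b)) (-‿inverseʳ b))) (zeroʳ η))))
  riemannSum-close {a} {b} {η} {u} {v} u≈v (cons t p (a≤t , t≤p) P) = ∣∣-resp
    (solve 5 (λ u v h r s → ((u :- v) :* h) :+ (r :- s) := (u :* h :+ r) :- (v :* h :+ s))
      refl (u t) (v t) (p - a) (riemannSum u P) (riemannSum v P))
    (≤-reflexive (solve 4 (λ η a p b → η :* (p :- a) :+ η :* (b :- p) := η :* (b :- a))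
        refl η a p b))
    (∣∣-+ (∣∣-* (u≈v t (a≤t , ≤-trans t≤p p≤b)) (∣∣-nonNeg (≤⇒0≤ a≤p) ≤-refl))
      (riemannSum-close (λ x (p≤x , x≤b) → u≈v x (≤-trans a≤p p≤x , x≤b)) P))
    where
    a≤p = ≤-trans a≤t t≤p
    p≤b = partition-≤ P

  riemannSum-+ :
    ∀ {a b} (u v : ℝ → ℝ) (P : TaggedPartition a b) →
    riemannSum u P + riemannSum v P ≈ riemannSum (λ x → u x + v x) P
  riemannSum-+ u v (nil _)            = +-identityˡ 0#
  riemannSum-+ {a} u v (cons t p _ P) = trans
    (solve 5 (λ u v h r s → (u :* h :+ r) :+ (v :* h :+ s) := (u :+ v) :* h :+ (r :+ s))
      refl (u t) (v t) (p - a) (riemannSum u P) (riemannSum v P))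
    (+-congˡ (riemannSum-+ u v P))

  riemannSum-* :
    ∀ {a b} (u : ℝ → ℝ) k (P : TaggedPartition a b) →
    riemannSum u P * k ≈ riemannSum (λ x → u x * k) P
  riemannSum-* u k (nil _)            = zeroˡ k
  riemannSum-* {a} u k (cons t p _ P) = trans
    (solve 4 (λ u h r k → (u :* h :+ r) :* k := (u :* k) :* h :+ r :* k)
      refl (u t) (p - a) (riemannSum u P) k)
    (+-congˡ (riemannSum-* u k P))

  riemannSum-0 : ∀ {a b} (P : TaggedPartition a b) → riemannSum (λ _ → 0#) P ≈ 0#
  riemannSum-0 (nil _)        = refl
  riemannSum-0 (cons t p _ P) = trans (+-cong (zeroˡ _) (riemannSum-0 P)) (+-identityˡ 0#)

  -- Integrals

  -- Lets later estimates be non-strict and carry any fixed factor `L`.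
  integral-by :
    ∀ {a b u I} L →
    (∀ ε → Positive ε → ∃[ δ ] (Positive δ ×
      ((P : TaggedPartition a b) → FinerThan δ P → ∣ riemannSum u P - I ∣ ≤ ε * L))) →
    HasIntegral a b u I
  integral-by L h η 0<η =
    let η′ , 0<η′ , 2η′<η = half 0<η
        ε , 0<ε , εL≤η′ = shrink 0<η′ L
        δ , 0<δ , near = h ε 0<ε
    in δ , 0<δ , λ P fine →
         ≤-<-trans (≤-trans (near P fine) (≤-trans εL≤η′ (x≤x+y (proj₁ 0<η′)))) 2η′<η

  -- Both integrals are compared with Riemann sums over one common fine partition. This gives
  -- uniqueness, bounds (by comparison with the zero function) and the dependence of an inner
  -- integral on its parameter.
  integral-distance :
    ∀ {a b u v I J η} → a ≤ b → (∀ x → x ∈[ a , b ] → ∣ u x - v x ∣ ≤ η) →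
    HasIntegral a b u I → HasIntegral a b v J → ∣ I - J ∣ ≤ η * (b - a)
  integral-distance {a} {b} {u} {v} {I} {J} {η} a≤b u≈v uI vJ = ≤-limit λ θ 0<θ →
    let ε , 0<ε , 2ε<θ = half 0<θ
        δ₁ , 0<δ₁ , near₁ = uI ε 0<ε
        δ₂ , 0<δ₂ , near₂ = vJ ε 0<ε
        δ , 0<δ , δ≤δ₁ , δ≤δ₂ = common 0<δ₁ 0<δ₂
        P , fine = fine-partition a≤b 0<δ
    in ∣∣-resp refl
      (≤-by (≤⇒0≤ (proj₁ 2ε<θ))
        (solve 3 (λ ε θ e → (e :+ θ) :- ((ε :+ e) :+ ε) := θ :- (ε :+ ε)) refl ε θ (η * (b - a))))
      (∣∣-triangle (∣∣-triangle
        (∣∣-sym (proj₁ (near₁ P (FinerThan-mono δ≤δ₁ P fine))))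
        (riemannSum-close u≈v P))
        (proj₁ (near₂ P (FinerThan-mono δ≤δ₂ P fine))))

  integral-unique :
    ∀ {a b u v I J} → a ≤ b → (∀ x → x ∈[ a , b ] → u x ≈ v x) →
    HasIntegral a b u I → HasIntegral a b v J → I ≈ J
  integral-unique {a} {b} a≤b u≈v uI vJ = ∣x-y∣≤0⇒x≈y (≤-resp refl (zeroˡ (b - a))
    (integral-distance a≤b (λ x x∈ → ∣∣-zero (trans (+-congʳ (u≈v x x∈)) (-‿inverseʳ _)) ≤-refl) uI vJ))

  integral-+ :
    ∀ {a b u v I J} → HasIntegral a b u I → HasIntegral a b v J →
    HasIntegral a b (λ x → u x + v x) (I + J)
  integral-+ {u = u} {v} {I} {J} uI vJ = integral-by (1# + 1#) λ ε 0<ε →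
    let δ₁ , 0<δ₁ , near₁ = uI ε 0<ε
        δ₂ , 0<δ₂ , near₂ = vJ ε 0<ε
        δ , 0<δ , δ≤δ₁ , δ≤δ₂ = common 0<δ₁ 0<δ₂
    in δ , 0<δ , λ P fine → ∣∣-resp
      (trans (solve 4 (λ r s I J → (r :- I) :+ (s :- J) := (r :+ s) :- (I :+ J))
               refl (riemannSum u P) (riemannSum v P) I J)
        (+-congʳ (riemannSum-+ u v P)))
      (≤-reflexive (solve 1 (λ ε → ε :+ ε := ε :* con (+ 2)) refl ε))
      (∣∣-+ (proj₁ (near₁ P (FinerThan-mono δ≤δ₁ P fine)))
            (proj₁ (near₂ P (FinerThan-mono δ≤δ₂ P fine))))

  integral-* :
    ∀ {a b u I} k → HasIntegral a b u I → HasIntegral a b (λ x → u x * k) (I * k)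
  integral-* {u = u} {I} k uI = integral-by ∣ k ∣ λ ε 0<ε →
    let δ , 0<δ , near = uI ε 0<ε
    in δ , 0<δ , λ P fine → ∣∣-resp
      (trans (solve 3 (λ r I k → (r :- I) :* k := r :* k :- I :* k) refl (riemannSum u P) I k)
        (+-congʳ (riemannSum-* u k P)))
      ≤-refl
      (∣∣-* (proj₁ (near P fine)) ≤-refl)

  integral-0 : ∀ {a b} → HasIntegral a b (λ _ → 0#) 0#
  integral-0 = integral-by 1# λ ε 0<ε → 1# , 0<1 , λ P _ →
    ∣∣-zero (trans (+-congʳ (riemannSum-0 P)) (-‿inverseʳ 0#))
      (*-nonNeg (proj₁ 0<ε) 0≤1)

  integral-sum :
    ∀ {a b} n (u : ℝ → Fin n → ℝ) (I : Fin n → ℝ) →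
    (∀ i → HasIntegral a b (λ x → u x i) (I i)) →
    HasIntegral a b (λ x → sum (u x)) (sum I)
  integral-sum zero    u I h = integral-0
  integral-sum (suc n) u I h =
    integral-+ (h Fin.zero)
      (integral-sum n (λ x i → u x (Fin.suc i)) (λ i → I (Fin.suc i)) (λ i → h (Fin.suc i)))

  -- Integrals are certified by a primitive Φ of u between the integers; in a
  -- short interval crossing an integer a Lipschitz bound suffices, as there
  -- are only finitely many of these.

  record IsPrimitive (a b : ℝ) (u Φ : ℝ → ℝ) : Set where
    field
      {constant} : ℝ
      smooth : ∀ ε → Positive ε → ∃[ δ ] (Positive δ × (∀ {p t q} →
        a ≤ p → t ∈[ p , q ] → q ≤ b → q - p < δ → ⌊ p ⌋ ≡ ⌊ q ⌋ →
        ∣ Error u Φ p t q ∣ ≤ ε * (q - p)))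
      jump : ∀ {p t q} → a ≤ p → t ∈[ p , q ] → q ≤ b → ℤ.suc ⌊ p ⌋ ≡ ⌊ q ⌋ →
        ∣ Error u Φ p t q ∣ ≤ constant * (q - p)

  primitive⇒integral : ∀ {a b u Φ} → IsPrimitive a b u Φ → HasIntegral a b u (Φ b - Φ a)
  primitive⇒integral {a} {b} {u} {Φ} Φ-primitive =
    integral-by ((b + fromℤ ⌊ b ⌋) - (a + fromℤ ⌊ a ⌋)) λ ε 0<ε →
    let δ₁ , 0<δ₁ , small = smooth ε 0<ε
        δ₂ , 0<δ₂ , δ₂C≤ε = shrink 0<ε ∣ constant ∣
        δ₃ , 0<δ₃ , δ₃≤δ₁ , δ₃≤δ₂ = common 0<δ₁ 0<δ₂
        δ , 0<δ , δ≤δ₃ , δ≤1 = common 0<δ₃ 0<1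
        -- The length pays for steps inside a unit cell. A step across an integer costs at most
        -- `δ₂ * ∣ constant ∣ ≤ ε`, which is what the unit increase of the floor adds to `Ψ`.
        Ψ = λ x → ε * (x + fromℤ ⌊ x ⌋)
    in δ , 0<δ , λ P fine → ≤-resp refl
      (solve 3 (λ ε x y → ε :* x :- ε :* y := ε :* (x :- y))
          refl ε (b + fromℤ ⌊ b ⌋) (a + fromℤ ⌊ a ⌋))
      (telescope {u = u} {Φ} {Ψ} 0<δ
        (λ {p} {t} {q} a≤p t∈ q≤b q-p<δ →
          let p≤q = ≤-trans (proj₁ t∈) (proj₂ t∈)
              kp = fromℤ ⌊ p ⌋
              kq = fromℤ ⌊ q ⌋
          in [ (λ same → ∣∣-resp refl
                 (≤-by (*-nonNeg (proj₁ 0<ε) (≤⇒0≤ (fromℤ-mono (⌊⌋-mono p≤q))))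
                   (solve 5 (λ ε p q kp kq → (ε :* (q :+ kq) :- ε :* (p :+ kp)) :- ε :* (q :- p) :=
                     ε :* (kq :- kp)) refl ε p q kp kq))
                 (small a≤p t∈ q≤b (<-≤-trans q-p<δ (≤-trans δ≤δ₃ δ₃≤δ₁)) same))
             , (λ next → ∣∣-resp refl
                 (≤-trans (*-monoʳ-≤ (≤⇒0≤ p≤q) (x≤∣x∣ constant))
                   (≤-trans (≤-resp (*-comm _ _) refl
                       (*-monoʳ-≤ (0≤∣x∣ constant) (≤-trans (proj₁ q-p<δ) (≤-trans δ≤δ₃ δ₃≤δ₂))))
                     (≤-trans δ₂C≤ε
                       (≤-by (*-nonNeg (proj₁ 0<ε) (≤⇒0≤ p≤q))
                         (trans (+-congʳ (+-congʳ (*-congˡ (+-congˡ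
                             (trans (reflexive (≡.cong fromℤ (≡.sym next))) (fromℤ-suc ⌊ p ⌋))))))
                           (solve 4 (λ ε p q kp → (ε :* (q :+ (kp :+ con (+ 1))) :- ε :* (p :+ kp)) :- ε :=
                             ε :* (q :- p)) refl ε p q kp))))))
                 (jump a≤p t∈ q≤b next))
             ]′ (⌊⌋-step p≤q (<-≤-trans q-p<δ δ≤1)))
        P fine)
    where open IsPrimitive Φ-primitive

  -- Tame functions

  ⌊⌋-between : ∀ {p s q} → s ∈[ p , q ] → ⌊ p ⌋ ≡ ⌊ q ⌋ → ⌊ s ⌋ ≡ ⌊ p ⌋
  ⌊⌋-between (p≤s , s≤q) p≡q = ℤ.≤-antisym
    (≡.subst (_ ℤ.≤_) (≡.sym p≡q) (⌊⌋-mono s≤q)) (⌊⌋-mono p≤s)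

  -- An iterated integral requires a function on all of ℝ, while values are available only on the
  -- interval. Excluded middle decides membership, and zero is the default elsewhere.
  choice : ∀ {P : ℝ → Set} {Q : ℝ → ℝ → Set} → (∀ x → P x → ∃ (Q x)) →
           ∃[ G ] (∀ x → P x → Q x (G x))
  choice {P} {Q} h = (λ x → value x em) , λ x → correct x em
    where
    value : ∀ x → Dec (P x) → ℝ
    value x (yes p) = proj₁ (h x p)
    value x (no _)  = 0#
    correct : ∀ x (d : Dec (P x)) → P x → Q x (value x d)
    correct x (yes p) _ = proj₂ (h x p)
    correct x (no ¬p) p = ⊥-elim (¬p p)

  -- The condition ⌊ s ⌋ ≡ ⌊ t ⌋ admits jumps at the integers.

  record Tame (a b : ℝ) (u : ℝ → ℝ) : Set where
    field
      bound       : ℝ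
      bounded     : ∀ x → x ∈[ a , b ] → ∣ u x ∣ ≤ bound
      oscillation : ∀ ε → Positive ε → ∃[ δ ] (Positive δ × (∀ {s t} →
        s ∈[ a , b ] → t ∈[ a , b ] → ⌊ s ⌋ ≡ ⌊ t ⌋ → ∣ s - t ∣ < δ → ∣ u s - u t ∣ ≤ ε))

  -- The lower Darboux integral from a to x is the supremum of the v with
  -- Lower x v.

  module Darboux {a b u} (tame : Tame a b u) where
    open Tame tame

    -- Lower sums grow at the right end, so that the last step can be cut off. The height `m` is any
    -- lower bound of `u` on the step, not necessarily its infimum.
    data Lower : ℝ → ℝ → Set where
      base : ∀ {x} → x ≈ a → Lower x 0#
      step : ∀ {p q v} m → p ≤ q → (∀ t → t ∈[ p , q ] → m ≤ u t) →
             Lower p v → Lower q (v + m * (q - p))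

    Lower-≥ : ∀ {x v} → Lower x v → a ≤ x
    Lower-≥ (base x≈a)       = ≤-reflexive (sym x≈a)
    Lower-≥ (step _ p≤q _ l) = ≤-trans (Lower-≥ l) p≤q

    Lower-≤ : ∀ {x v} → x ≤ b → Lower x v → v ≤ bound * (x - a)
    Lower-≤ x≤b (base x≈a) = ≤-reflexive
      (sym (trans (*-congˡ (trans (+-congʳ x≈a) (-‿inverseʳ a))) (zeroʳ bound)))
    Lower-≤ q≤b (step {p} {q} {v} m p≤q m≤u l) = ≤-by
      (+-nonNeg (≤⇒0≤ (Lower-≤ (≤-trans p≤q q≤b) l))
        (*-nonNeg (≤⇒0≤ (≤-trans (m≤u q (p≤q , ≤-refl))
            (≤-trans (x≤∣x∣ (u q)) (bounded q (≤-trans (Lower-≥ l) p≤q , q≤b)))))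
          (≤⇒0≤ p≤q)))
      (solve 6 (λ M m v a p q → M :* (q :- a) :- (v :+ m :* (q :- p)) :=
        (M :* (p :- a) :- v) :+ (M :- m) :* (q :- p)) refl bound m v a p q)

    primitive-choice : ∃[ Φ ] (∀ x → x ∈[ a , b ] → IsSupremum (Lower x) (Φ x))
    primitive-choice = choice λ x x∈ → supremum (Lower x)
      -- A single step of height `- bound` shows that lower sums exist.
      (_ , step (- bound) (proj₁ x∈)
             (λ t t∈ → ≤-by (∣∣-lower (bounded t (proj₁ t∈ , ≤-trans (proj₂ t∈) (proj₂ x∈))))
               (solve 2 (λ M y → y :- (:- M) := M :+ y) refl bound (u t)))
             (base refl))
      (_ , λ _ → Lower-≤ (proj₂ x∈))

    Φ : ℝ → ℝ
    Φ = proj₁ primitive-choice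

    Lower-≤Φ : ∀ {x v} → x ≤ b → Lower x v → v ≤ Φ x
    Lower-≤Φ x≤b l = proj₁ (proj₂ primitive-choice _ (Lower-≥ l , x≤b)) _ l

    Φ-least : ∀ {x s} → x ∈[ a , b ] → (∀ v → Lower x v → v ≤ s) → Φ x ≤ s
    Φ-least x∈ h = proj₂ (proj₂ primitive-choice _ x∈) _ h

    -- Every lower sum at `p` extends by a step of height `m` to one at `q`, so `Φ q - m * (q - p)`
    -- bounds the lower sums at `p`.
    Φ-lower : ∀ {p q m} → a ≤ p → p ≤ q → q ≤ b → (∀ t → t ∈[ p , q ] → m ≤ u t) →
              Φ p + m * (q - p) ≤ Φ q
    Φ-lower {p} {q} {m} a≤p p≤q q≤b m≤u = ≤-by
      (≤⇒0≤ (Φ-least {p} {Φ q - m * (q - p)} (a≤p , ≤-trans p≤q q≤b) λ v l → ≤-by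
        (≤⇒0≤ (Lower-≤Φ q≤b (step m p≤q m≤u l)))
        (solve 3 (λ F e v → (F :- e) :- v := F :- (v :+ e)) refl (Φ q) (m * (q - p)) v)))
      (solve 3 (λ F e G → F :- (G :+ e) := (F :- e) :- G) refl (Φ q) (m * (q - p)) (Φ p))

    -- An upper estimate drawn from lower sums by cutting them at `p`. A last step starting at
    -- `r ≤ p` is shortened to end at `p`, and the part removed is at most `n * (q - p)` since
    -- `m ≤ u p ≤ n`. A last step starting beyond `p` satisfies `m ≤ u q ≤ n` and is peeled off by
    -- recursion.
    Lower-upper : ∀ {p q n v} → a ≤ p → p ≤ q → q ≤ b → (∀ t → t ∈[ p , q ] → u t ≤ n) →
                  Lower q v → v ≤ Φ p + n * (q - p)
    Lower-upper {p} {q} {n} a≤p p≤q q≤b u≤n (base q≈a) = ≤-resp (+-identityʳ 0#)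
      (+-congˡ (sym (trans (*-congˡ (trans (+-congˡ (-‿cong p≈q)) (-‿inverseʳ q))) (zeroʳ n))))
      (+-mono-≤ (Lower-≤Φ (≤-trans p≤q q≤b) (base (trans p≈q q≈a))) ≤-refl)
      where
      p≈q : p ≈ q
      p≈q = antisym p≤q (≤-trans (≤-reflexive q≈a) a≤p)
    Lower-upper {p} {q} {n} a≤p p≤q q≤b u≤n (step {r} {v = v} m r≤q m≤u l) with total r p
    ... | inj₁ r≤p = ≤-by
      (+-nonNeg
        (≤⇒0≤ (Lower-≤Φ (≤-trans p≤q q≤b)
          (step m r≤p (λ t t∈ → m≤u t (proj₁ t∈ , ≤-trans (proj₂ t∈) p≤q)) l)))
        (*-nonNeg (≤⇒0≤ (≤-trans (m≤u p (r≤p , p≤q)) (u≤n p (≤-refl , p≤q)))) (≤⇒0≤ p≤q)))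
      (solve 7 (λ F n m v p q r → (F :+ n :* (q :- p)) :- (v :+ m :* (q :- r)) :=
        (F :- (v :+ m :* (p :- r))) :+ (n :- m) :* (q :- p)) refl (Φ p) n m v p q r)
    ... | inj₂ p≤r = ≤-by
      (+-nonNeg
        (≤⇒0≤ (Lower-upper a≤p p≤r (≤-trans r≤q q≤b)
          (λ t t∈ → u≤n t (proj₁ t∈ , ≤-trans (proj₂ t∈) r≤q)) l))
        (*-nonNeg (≤⇒0≤ (≤-trans (m≤u q (r≤q , ≤-refl)) (u≤n q (p≤q , ≤-refl)))) (≤⇒0≤ r≤q)))
      (solve 7 (λ F n m v p q r → (F :+ n :* (q :- p)) :- (v :+ m :* (q :- r)) :=
        ((F :+ n :* (r :- p)) :- v) :+ (n :- m) :* (q :- r)) refl (Φ p) n m v p q r)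

    -- On [p,q] the function lies between `u t - η` and `u t + η`; these constants serve as the
    -- heights in the lower and upper estimates of the increment of `Φ`.
    error-≤ : ∀ {p t q η} → a ≤ p → t ∈[ p , q ] → q ≤ b →
              (∀ s → s ∈[ p , q ] → ∣ u s - u t ∣ ≤ η) → ∣ Error u Φ p t q ∣ ≤ η * (q - p)
    error-≤ {p} {t} {q} {η} a≤p t∈ q≤b near = ∣∣-by
      (≤-resp refl
        (solve 5 (λ η y h F G → G :- (F :+ (y :- η) :* h) := η :* h :- (y :* h :- (G :- F)))
          refl η (u t) (q - p) (Φ p) (Φ q))
        (≤⇒0≤ (Φ-lower a≤p p≤q q≤b λ s s∈ → ≤-by (∣∣-lower (near s s∈))
          (solve 3 (λ η x y → x :- (y :- η) := η :+ (x :- y)) refl η (u s) (u t)))))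
      (≤-resp refl
        (solve 5 (λ η y h F G → (F :+ (y :+ η) :* h) :- G := η :* h :+ (y :* h :- (G :- F)))
          refl η (u t) (q - p) (Φ p) (Φ q))
        (≤⇒0≤ (Φ-least (≤-trans a≤p p≤q , q≤b) λ v → Lower-upper a≤p p≤q q≤b λ s s∈ →
          ≤-by (∣∣-upper (near s s∈))
            (solve 3 (λ η x y → (y :+ η) :- x := η :- (x :- y)) refl η (u s) (u t)))))
      where p≤q = ≤-trans (proj₁ t∈) (proj₂ t∈)

    isPrimitive : IsPrimitive a b u Φ
    isPrimitive = record
      { constant = bound + bound
      ; smooth   = λ ε 0<ε →
          let δ , 0<δ , near = oscillation ε 0<ε
          in δ , 0<δ , λ a≤p t∈ q≤b q-p<δ same → error-≤ a≤p t∈ q≤b λ s s∈ →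
               near (widen a≤p q≤b s∈) (widen a≤p q≤b t∈)
                 (≡.trans (⌊⌋-between s∈ same) (≡.sym (⌊⌋-between t∈ same)))
                 (≤-<-trans (∈-distance s∈ t∈) q-p<δ)
      ; jump     = λ a≤p t∈ q≤b _ → error-≤ a≤p t∈ q≤b λ s s∈ →
          ∣∣-+ (bounded s (widen a≤p q≤b s∈)) (∣∣-neg (bounded _ (widen a≤p q≤b t∈)))
      }
      where
      widen : ∀ {p q s} → a ≤ p → q ≤ b → s ∈[ p , q ] → s ∈[ a , b ]
      widen a≤p q≤b (p≤s , s≤q) = ≤-trans a≤p p≤s , ≤-trans s≤q q≤b

  tame⇒integrable : ∀ {a b u} → Tame a b u → ∃ (HasIntegral a b u)
  tame⇒integrable tame = _ , primitive⇒integral (Darboux.isPrimitive tame)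

  -- Tame functions of two variables

  module _ (a b c d : ℝ) where

    -- The modulus `δ` is uniform in both variables together; this is what carries tameness in x
    -- over to the inner integral.
    record Tame₂ (h : ℝ → ℝ → ℝ) : Set where
      field
        bound       : ℝ
        bounded     : ∀ x y → x ∈[ a , b ] → y ∈[ c , d ] → ∣ h x y ∣ ≤ bound
        oscillation : ∀ ε → Positive ε → ∃[ δ ] (Positive δ × (∀ {s x t y} →
          s ∈[ a , b ] → x ∈[ a , b ] → t ∈[ c , d ] → y ∈[ c , d ] →
          ⌊ s ⌋ ≡ ⌊ x ⌋ → ⌊ t ⌋ ≡ ⌊ y ⌋ → ∣ s - x ∣ < δ → ∣ t - y ∣ < δ →
          ∣ h s t - h x y ∣ ≤ ε))

  module _ {a b c d : ℝ} where

    ∣x-x∣<δ : ∀ {x δ} → Positive δ → ∣ x - x ∣ < δ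
    ∣x-x∣<δ {x} = ≤-<-trans (∣∣-zero (-‿inverseʳ x) ≤-refl)

    Tame₂-sliceˣ : ∀ {h y} → Tame₂ a b c d h → y ∈[ c , d ] → Tame a b (λ x → h x y)
    Tame₂-sliceˣ {h} {y} tame y∈ = record
      { bound       = bound
      ; bounded     = λ x x∈ → bounded x y x∈ y∈
      ; oscillation = λ ε 0<ε → let δ , 0<δ , near = oscillation ε 0<ε in
          δ , 0<δ , λ s∈ t∈ s≡t s-t<δ → near s∈ t∈ y∈ y∈ s≡t ≡.refl s-t<δ (∣x-x∣<δ 0<δ)
      }
      where open Tame₂ tame

    Tame₂-sliceʸ : ∀ {h x} → Tame₂ a b c d h → x ∈[ a , b ] → Tame c d (h x)
    Tame₂-sliceʸ {h} {x} tame x∈ = record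
      { bound       = bound
      ; bounded     = λ y y∈ → bounded x y x∈ y∈
      ; oscillation = λ ε 0<ε → let δ , 0<δ , near = oscillation ε 0<ε in
          δ , 0<δ , λ s∈ t∈ s≡t s-t<δ → near x∈ x∈ s∈ t∈ ≡.refl s≡t (∣x-x∣<δ 0<δ) s-t<δ
      }
      where open Tame₂ tame

    -- Two inner integrals at nearby abscissae in the same unit cell have uniformly close
    -- integrands, so they differ by at most `ε′ * (d - c)`. The inner integral is thus tame in x
    -- and can be integrated again.
    tame⇒iterated-integrable : c ≤ d → ∀ {h} → Tame₂ a b c d h → ∃ (HasIteratedIntegral a b c d h)
    tame⇒iterated-integrable c≤d {h} tame =
      let G , hG = choice λ x x∈ → tame⇒integrable (Tame₂-sliceʸ tame x∈)
          I , GI = tame⇒integrable (record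
            { bound       = bound * (d - c)
            ; bounded     = λ x x∈ → ∣∣-resp (trans (+-congˡ -0#≈0#) (+-identityʳ (G x))) ≤-refl
                (integral-distance c≤d
                  (λ y y∈ → ∣∣-resp (sym (trans (+-congˡ -0#≈0#) (+-identityʳ (h x y)))) ≤-refl
                    (bounded x y x∈ y∈))
                  (hG x x∈) integral-0)
            ; oscillation = λ ε 0<ε →
                let ε′ , 0<ε′ , ε′L≤ε = shrink 0<ε (d - c)
                    δ , 0<δ , near = oscillation ε′ 0<ε′
                in δ , 0<δ , λ s∈ t∈ s≡t s-t<δ → ≤-trans
                  (integral-distance c≤d
                    (λ y y∈ → near s∈ t∈ y∈ y∈ s≡t ≡.refl s-t<δ (∣x-x∣<δ 0<δ))
                    (hG _ s∈) (hG _ t∈))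
                  ε′L≤ε
            })
      in I , G , hG , GI
      where open Tame₂ tame

    Tame₂-* : ∀ {h k} → Tame₂ a b c d h → Tame₂ a b c d k → Tame₂ a b c d (λ x y → h x y * k x y)
    Tame₂-* {h} {k} h-tame k-tame = record
      { bound       = H.bound * K.bound
      ; bounded     = λ x y x∈ y∈ → ∣∣-* (H.bounded x y x∈ y∈) (K.bounded x y x∈ y∈)
      ; oscillation = λ ε 0<ε →
          let ε′ , 0<ε′ , ε′L≤ε = shrink 0<ε (H.bound + K.bound)
              δ₁ , 0<δ₁ , near₁ = H.oscillation ε′ 0<ε′
              δ₂ , 0<δ₂ , near₂ = K.oscillation ε′ 0<ε′
              δ , 0<δ , δ≤δ₁ , δ≤δ₂ = common 0<δ₁ 0<δ₂
          in δ , 0<δ , λ {s} {x} {t} {y} s∈ x∈ t∈ y∈ s≡x t≡y s-x<δ t-y<δ → ∣∣-resp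
               (solve 4 (λ h h′ k k′ → (h :- h′) :* k :+ h′ :* (k :- k′) := h :* k :- h′ :* k′)
                 refl (h s t) (h x y) (k s t) (k x y))
               (≤-trans (≤-reflexive (solve 3 (λ ε M N → ε :* N :+ M :* ε := ε :* (M :+ N))
                   refl ε′ H.bound K.bound)) ε′L≤ε)
               (∣∣-+
                 (∣∣-* (near₁ s∈ x∈ t∈ y∈ s≡x t≡y (<-≤-trans s-x<δ δ≤δ₁) (<-≤-trans t-y<δ δ≤δ₁))
                      (K.bounded s t s∈ t∈))
                 (∣∣-* (H.bounded x y x∈ y∈)
                      (near₂ s∈ x∈ t∈ y∈ s≡x t≡y (<-≤-trans s-x<δ δ≤δ₂) (<-≤-trans t-y<δ δ≤δ₂))))
      }
      where
      module H = Tame₂ h-tame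
      module K = Tame₂ k-tame

    frac-difference : ∀ {s t δ} → ⌊ s ⌋ ≡ ⌊ t ⌋ → ∣ s - t ∣ < δ → ∣ frac s - frac t ∣ ≤ δ
    frac-difference {s} {t} s≡t s-t<δ = ∣∣-resp
      (trans (solve 3 (λ s t k → s :- t := (s :- k) :- (t :- k)) refl s t (fromℤ ⌊ s ⌋))
        (+-congˡ (-‿cong (+-congˡ (-‿cong (reflexive (≡.cong fromℤ s≡t)))))))
      (proj₁ s-t<δ) ≤-refl

    Tame₂-fracˣ : Tame₂ a b c d (λ x _ → frac x)
    Tame₂-fracˣ = record
      { bound       = 1#
      ; bounded     = λ x _ _ _ → ∣frac∣≤1 x
      ; oscillation = λ ε 0<ε → ε , 0<ε , λ _ _ _ _ s≡x _ s-x<ε _ → frac-difference s≡x s-x<ε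
      }

    Tame₂-fracʸ : Tame₂ a b c d (λ _ y → frac y)
    Tame₂-fracʸ = record
      { bound       = 1#
      ; bounded     = λ _ y _ _ → ∣frac∣≤1 y
      ; oscillation = λ ε 0<ε → ε , 0<ε , λ _ _ _ _ _ t≡y _ t-y<ε → frac-difference t≡y t-y<ε
      }

    continuous⇒tame : a ≤ b → c ≤ d → ∀ {h} → IsContinuous a b c d h → Tame₂ a b c d h
    continuous⇒tame a≤b c≤d {h} continuous =
      let M , h≤M = compactness₂ a≤b c≤d (λ M (x , y) → ∣ h x y ∣ ≤ M)
            (λ M N → M ⊔ N , (λ p → ≤-trans p (x≤x⊔y M N)) , (λ p → ≤-trans p (x≤y⊔x M N)))
            λ x y x∈ y∈ → let δ , 0<δ , near = continuous x y x∈ y∈ 1# 0<1 in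
              ∣ h x y ∣ + 1# , δ , 0<δ , λ s t s∈ t∈ s-x<δ t-y<δ → ∣∣-resp
                (solve 2 (λ p q → q :+ (p :- q) := p) refl (h s t) (h x y)) ≤-refl
                (∣∣-+ ≤-refl (proj₁ (near s t s∈ t∈ s-x<δ t-y<δ)))
      in record
        { bound       = M
        ; bounded     = h≤M
        ; oscillation = λ ε 0<ε →
            let (δ , 0<δ) , near = uniformly ε 0<ε
            in δ , 0<δ , λ s∈ x∈ t∈ y∈ _ _ → near _ _ x∈ y∈ _ _ s∈ t∈
        }
      where
      open MaxOp (Max.maxOperator totalOrder) using (x≤x⊔y; x≤y⊔x)
      uniformly : ∀ ε → Positive ε → Σ (∃ Positive) λ (δ , _) →
        (∀ x y → x ∈[ a , b ] → y ∈[ c , d ] →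
        ∀ s t → s ∈[ a , b ] → t ∈[ c , d ] → ∣ s - x ∣ < δ → ∣ t - y ∣ < δ → ∣ h s t - h x y ∣ ≤ ε)
      uniformly ε 0<ε = compactness₂ a≤b c≤d {∃ Positive}
        (λ (δ , _) (x , y) →
          ∀ s t → s ∈[ a , b ] → t ∈[ c , d ] → ∣ s - x ∣ < δ → ∣ t - y ∣ < δ → ∣ h s t - h x y ∣ ≤ ε)
        (λ (δ₁ , 0<δ₁) (δ₂ , 0<δ₂) → let δ , 0<δ , δ≤δ₁ , δ≤δ₂ = common 0<δ₁ 0<δ₂ in (δ , 0<δ) ,
          (λ near s t s∈ t∈ p q → near s t s∈ t∈ (<-≤-trans p δ≤δ₁) (<-≤-trans q δ≤δ₁)) ,
          (λ near s t s∈ t∈ p q → near s t s∈ t∈ (<-≤-trans p δ≤δ₂) (<-≤-trans q δ≤δ₂)))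
        λ x y x∈ y∈ →
          let ε′ , 0<ε′ , 2ε′<ε = half 0<ε
              δ , 0<δ , near = continuous x y x∈ y∈ ε′ 0<ε′
              δ′ , 0<δ′ , 2δ′<δ = half 0<δ
              δ′<δ = ≤-<-trans (x≤x+y (proj₁ 0<δ′)) 2δ′<δ
          in (δ′ , 0<δ′) , δ′ , 0<δ′ , λ x′ y′ x′∈ y′∈ x′-x<δ′ y′-y<δ′ s t s∈ t∈ s-x′<δ′ t-y′<δ′ →
            -- Both points lie within `δ` of the centre (x, y), the first by way of the second, so
            -- the values are compared through `h x y`.
            ≤-trans (∣∣-triangle
              (proj₁ (near s t s∈ t∈
                (≤-<-trans (∣∣-triangle (proj₁ s-x′<δ′) (proj₁ x′-x<δ′)) 2δ′<δ)
                (≤-<-trans (∣∣-triangle (proj₁ t-y′<δ′) (proj₁ y′-y<δ′)) 2δ′<δ)))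
              (∣∣-sym (proj₁ (near x′ y′ x′∈ y′∈
                (<-≤-trans x′-x<δ′ (proj₁ δ′<δ)) (<-≤-trans y′-y<δ′ (proj₁ δ′<δ))))))
              (proj₁ 2ε′<ε)

  -- Lipschitz bounds from bounded derivatives

  increment-≤ :
    ∀ {a b} {g g′ : ℝ → ℝ} → (∀ x → x ∈[ a , b ] → HasDerivativeAt a b g (g′ x) x) →
    ∀ {K} → (∀ x → x ∈[ a , b ] → ∣ g′ x ∣ ≤ K) →
    ∀ {p q} → a ≤ p → p ≤ q → q ≤ b → ∣ g q - g p ∣ ≤ K * (q - p)
  increment-≤ {g = g} {g′} derivative g′≤K {p} {q} a≤p p≤q q≤b = ∣∣-resp
    (solve 2 (λ i h → i :- con (+ 0) :* h := i) refl (g q - g p) (q - p)) ≤-refl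
    (mean-value g g′ derivative a≤p p≤q q≤b λ x (p≤x , x≤q) → ∣∣-resp
      (sym (trans (+-congˡ -0#≈0#) (+-identityʳ (g′ x)))) ≤-refl
      (g′≤K x (≤-trans a≤p p≤x , ≤-trans x≤q q≤b)))

  lipschitz :
    ∀ {a b} {g g′ : ℝ → ℝ} → (∀ x → x ∈[ a , b ] → HasDerivativeAt a b g (g′ x) x) →
    ∀ {K} → (∀ x → x ∈[ a , b ] → ∣ g′ x ∣ ≤ K) →
    ∀ {s t η} → s ∈[ a , b ] → t ∈[ a , b ] → ∣ s - t ∣ ≤ η → ∣ g s - g t ∣ ≤ K * η
  lipschitz {g′ = g′} derivative g′≤K {s} {t} s∈ t∈ s-t≤η =
    [ (λ s≤t → ∣∣-sym (≤-trans (increment-≤ derivative g′≤K (proj₁ s∈) s≤t (proj₂ t∈))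
        (*-monoˡ-≤ 0≤K (≤-trans (x≤∣x∣ _) (∣∣-sym s-t≤η)))))
    , (λ t≤s → ≤-trans (increment-≤ derivative g′≤K (proj₁ t∈) t≤s (proj₂ s∈))
        (*-monoˡ-≤ 0≤K (≤-trans (x≤∣x∣ _) s-t≤η)))
    ]′ (total s t)
    where 0≤K = ∣∣-bound-nonNeg (g′≤K s s∈)

  module _ {a b c d : ℝ} where

    -- One coordinate moves at a time, from (s,t) through (x,t) to (x,y), and both segments stay
    -- inside the rectangle. The bound on `f` measures the distance from the corner (a,c).
    bounded-partials⇒tame : a ≤ b → c ≤ d → ∀ {f fx fy} →
      IsPartialX a b c d f fx → IsPartialY a b c d f fy →
      Tame₂ a b c d fx → Tame₂ a b c d fy → Tame₂ a b c d f
    bounded-partials⇒tame a≤b c≤d {f} partial-x partial-y fx-tame fy-tame = record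
      { bound       = ∣ f a c ∣ + (X.bound * (b - a) + Y.bound * (d - c))
      ; bounded     = λ x y x∈ y∈ → ∣∣-resp
          (solve 2 (λ p q → q :+ (p :- q) := p) refl (f x y) (f a c)) ≤-refl
          (∣∣-+ ≤-refl (lipschitz₂ x∈ (≤-refl , a≤b) y∈ (≤-refl , c≤d)
            (∈-distance x∈ (≤-refl , a≤b)) (∈-distance y∈ (≤-refl , c≤d))))
      ; oscillation = λ ε 0<ε →
          let δ , 0<δ , δL≤ε = shrink 0<ε (X.bound + Y.bound)
          in δ , 0<δ , λ s∈ x∈ t∈ y∈ _ _ s-x<δ t-y<δ → ≤-trans
               (lipschitz₂ s∈ x∈ t∈ y∈ (proj₁ s-x<δ) (proj₁ t-y<δ))
               (≤-trans (≤-reflexive (solve 3 (λ δ M N → M :* δ :+ N :* δ := δ :* (M :+ N))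
                 refl δ X.bound Y.bound)) δL≤ε)
      }
      where
      module X = Tame₂ fx-tame
      module Y = Tame₂ fy-tame
      lipschitz₂ : ∀ {s x t y η θ} → s ∈[ a , b ] → x ∈[ a , b ] → t ∈[ c , d ] → y ∈[ c , d ] →
        ∣ s - x ∣ ≤ η → ∣ t - y ∣ ≤ θ → ∣ f s t - f x y ∣ ≤ X.bound * η + Y.bound * θ
      lipschitz₂ {x = x} {t} s∈ x∈ t∈ y∈ s-x≤η t-y≤θ = ∣∣-triangle
        (lipschitz (λ x x∈ → partial-x x t x∈ t∈) (λ x x∈ → X.bounded x t x∈ t∈) s∈ x∈ s-x≤η)
        (lipschitz (λ y y∈ → partial-y x y x∈ y∈) (λ y y∈ → Y.bounded x y x∈ y∈) t∈ y∈ t-y≤θ)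

  -- The summation formula in one variable

  sumℤ-empty : ∀ a (h : ℤ → ℝ) → sumℤ a a h ≈ 0#
  sumℤ-empty a h rewrite ℤ.i≡j⇒i-j≡0 {a} ≡.refl = refl

  -- The number of terms is an absolute value; `a ≤ k` guarantees that passing to `ℤ.suc k` adds a
  -- term instead of dropping one.
  sumℤ-suc : ∀ {a k} (h : ℤ → ℝ) → a ℤ.≤ k → sumℤ a (ℤ.suc k) h ≈ sumℤ a k h + h (ℤ.suc k)
  sumℤ-suc {a} {k} h a≤k = trans
    (reflexive (≡.cong partial length-suc))
    (trans (sum-init-last {n = n} term)
      (+-cong (sum-cong-≋ {n = n} λ i → reflexive (≡.cong (λ m → h (a ℤ.+ + suc m)) (toℕ-inject₁ i)))
              (reflexive (≡.cong h last-index))))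
    where
    open MonoidSum +-monoid using (sum-init-last; sum-cong-≋)
    n : ℕ
    n = ℤ.∣ k ℤ.- a ∣
    term : ∀ {m} → Fin m → ℝ
    term i = h (a ℤ.+ + suc (Fin.toℕ i))
    partial : ℕ → ℝ
    partial m = sum {m} term
    +n≡k-a : + n ≡ k ℤ.- a
    +n≡k-a = ℤ.0≤i⇒+∣i∣≡i (ℤ.i≤j⇒0≤j-i a≤k)
    length-suc : ℤ.∣ ℤ.suc k ℤ.- a ∣ ≡ suc n
    length-suc = ≡.cong ℤ.∣_∣ (≡.trans (ℤ.+-assoc (+ 1) k (ℤ.- a)) (≡.cong ℤ.suc (≡.sym +n≡k-a)))
    last-index : a ℤ.+ + suc (Fin.toℕ (Fin.fromℕ n)) ≡ ℤ.suc k
    last-index = begin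
      a ℤ.+ + suc (Fin.toℕ (Fin.fromℕ n))  ≡⟨ ≡.cong (λ m → a ℤ.+ ℤ.suc (+ m)) (toℕ-fromℕ n) ⟩
      a ℤ.+ ℤ.suc (+ n)                    ≡⟨ ≡.cong (λ m → a ℤ.+ ℤ.suc m) +n≡k-a ⟩
      a ℤ.+ ℤ.suc (k ℤ.- a)                ≡⟨ ℤ.+-comm a _ ⟩
      ℤ.suc (k ℤ.- a) ℤ.+ a                ≡⟨ ℤ.+-assoc (+ 1) (k ℤ.- a) a ⟩
      ℤ.suc (k ℤ.- a ℤ.+ a)                ≡⟨ ≡.cong ℤ.suc (ℤ.+-assoc k (ℤ.- a) a) ⟩
      ℤ.suc (k ℤ.+ (ℤ.- a ℤ.+ a))          ≡⟨ ≡.cong (λ m → ℤ.suc (k ℤ.+ m)) (ℤ.+-inverseˡ a) ⟩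
      ℤ.suc (k ℤ.+ ℤ.0ℤ)                   ≡⟨ ≡.cong ℤ.suc (ℤ.+-identityʳ k) ⟩
      ℤ.suc k                              ∎
      where open ≡.≡-Reasoning

  integral-value : ∀ {a b u I J} → I ≈ J → HasIntegral a b u I → HasIntegral a b u J
  integral-value I≈J uI ε 0<ε = let δ , 0<δ , near = uI ε 0<ε in
    δ , 0<δ , λ P fine →
      ≤-<-trans (∣∣-resp (+-congˡ (-‿cong I≈J)) ≤-refl ≤-refl) (near P fine)

  module Euler
    {a b : ℤ} (a≤b : a ℤ.≤ b) {g g′ : ℝ → ℝ}
    (derivative : ∀ x → x ∈[ fromℤ a , fromℤ b ] → HasDerivativeAt (fromℤ a) (fromℤ b) g (g′ x) x)
    (g-tame : Tame (fromℤ a) (fromℤ b) g) (g′-tame : Tame (fromℤ a) (fromℤ b) g′)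
    where

    module G  = Tame g-tame
    module G′ = Tame g′-tame

    u : ℝ → ℝ
    u x = g x + g′ x * frac x

    S : ℤ → ℝ
    S k = sumℤ a k (λ m → g (fromℤ m))

    Φ : ℝ → ℝ
    Φ x = g x * frac x + S ⌊ x ⌋

    u-at : ∀ {x k} → ⌊ x ⌋ ≡ k → u x ≈ g x + g′ x * (x - fromℤ k)
    u-at ≡.refl = refl

    Φ-at : ∀ {x k} → ⌊ x ⌋ ≡ k → Φ x ≈ g x * (x - fromℤ k) + S k
    Φ-at ≡.refl = refl

    smooth : ∀ ε → Positive ε → ∃[ δ ] (Positive δ × (∀ {p t q} →
      fromℤ a ≤ p → t ∈[ p , q ] → q ≤ fromℤ b → q - p < δ → ⌊ p ⌋ ≡ ⌊ q ⌋ →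
      ∣ Error u Φ p t q ∣ ≤ ε * (q - p)))
    smooth ε 0<ε =
      let ε′ , 0<ε′ , 2ε′<ε = half 0<ε
          δ₁ , 0<δ₁ , near = G′.oscillation ε′ 0<ε′
          -- `δ₁` controls the Taylor remainders; `δ₂` makes the second order term, at most
          -- `G′.bound * (q - p) * (q - p)`, no larger than `ε′ * (q - p)`.
          δ₂ , 0<δ₂ , δ₂K≤ε′ = shrink 0<ε′ G′.bound
          δ , 0<δ , δ≤δ₁ , δ≤δ₂ = common 0<δ₁ 0<δ₂
      in δ , 0<δ , λ {p} {t} {q} a≤p t∈ q≤b q-p<δ same →
        estimate ε′ a≤p t∈ q≤b same (proj₁ 2ε′<ε)
          (≤-trans (*-monoʳ-≤ (∣∣-bound-nonNeg (G′.bounded t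
              (≤-trans a≤p (proj₁ t∈) , ≤-trans (proj₂ t∈) q≤b)))
            (≤-trans (proj₁ q-p<δ) δ≤δ₂)) δ₂K≤ε′)
          λ s s∈ → near
            (≤-trans a≤p (proj₁ s∈) , ≤-trans (proj₂ s∈) q≤b)
            (≤-trans a≤p (proj₁ t∈) , ≤-trans (proj₂ t∈) q≤b)
            (≡.trans (⌊⌋-between s∈ same) (≡.sym (⌊⌋-between t∈ same)))
            (≤-<-trans (∈-distance s∈ t∈) (<-≤-trans q-p<δ δ≤δ₁))
      where
      -- With k = ⌊ p ⌋, the error is the sum of the two first order Taylor
      -- remainders of g at t, weighted by q - k and p - k, and of the second
      -- order term g′ t * (q - p) * (q + p - 2t), up to sign.

      estimate : ∀ ε′ {p t q} → fromℤ a ≤ p → t ∈[ p , q ] → q ≤ fromℤ b → ⌊ p ⌋ ≡ ⌊ q ⌋ →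
        ε′ + ε′ ≤ ε → (q - p) * G′.bound ≤ ε′ → (∀ s → s ∈[ p , q ] → ∣ g′ s - g′ t ∣ ≤ ε′) →
        ∣ Error u Φ p t q ∣ ≤ ε * (q - p)
      estimate ε′ {p} {t} {q} a≤p (p≤t , t≤q) q≤b same 2ε′≤ε hK≤ε′ near = ∣∣-resp
        (trans
          (solve 9 (λ gp gt gq g′ p t q k S →
            ((:- (((gq :- gt) :- g′ :* (q :- t)) :* (q :- k))) :+
              (:- (((gt :- gp) :- g′ :* (t :- p)) :* (p :- k))))
              :+ (:- (g′ :* ((q :- p) :* (q :- t :- (t :- p)))))
            := (gt :+ g′ :* (t :- k)) :* (q :- p) :- ((gq :* (q :- k) :+ S) :- (gp :* (p :- k) :+ S)))
            refl (g p) (g t) (g q) (g′ t) p t q k (S ⌊ p ⌋))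
          (sym (+-cong (*-congʳ (u-at (⌊⌋-between (p≤t , t≤q) same)))
            (-‿cong (+-cong (Φ-at (≡.sym same)) (-‿cong (Φ-at {p} ≡.refl)))))))
        (≤-by (+-nonNeg (*-nonNeg (≤⇒0≤ 2ε′≤ε) (≤⇒0≤ p≤q)) (*-nonNeg (≤⇒0≤ hK≤ε′) (≤⇒0≤ p≤q)))
          (solve 6 (λ ε ε′ p t q K →
            ε :* (q :- p) :-
              (((ε′ :* (q :- t)) :* con (+ 1) :+ (ε′ :* (t :- p)) :* con (+ 1)) :+ K :* ((q :- p) :* (q :- p)))
            := (ε :- (ε′ :+ ε′)) :* (q :- p) :+ (ε′ :- (q :- p) :* K) :* (q :- p))
                refl ε ε′ p t q G′.bound))
        (∣∣-+ (∣∣-+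
          (∣∣-neg (∣∣-* (mean-value g g′ derivative (≤-trans a≤p p≤t) t≤q q≤b
              (λ s (t≤s , s≤q) → near s (≤-trans p≤t t≤s , s≤q)))
            (unit {q} (≡.sym same))))
          (∣∣-neg (∣∣-* (mean-value g g′ derivative a≤p p≤t (≤-trans t≤q q≤b)
              (λ s (p≤s , s≤t) → near s (p≤s , ≤-trans s≤t t≤q)))
            (unit {p} ≡.refl))))
          (∣∣-neg (∣∣-* (G′.bounded t (≤-trans a≤p p≤t , ≤-trans t≤q q≤b))
            (∣∣-* (∣∣-nonNeg (≤⇒0≤ p≤q) ≤-refl)
              (∣∣-resp refl (≤-reflexive (solve 3 (λ p t q → (q :- t) :+ (t :- p) := q :- p)
                  refl p t q))
                (∣∣-+ (∣∣-nonNeg (≤⇒0≤ t≤q) ≤-refl) (∣∣-neg (∣∣-nonNeg (≤⇒0≤ p≤t) ≤-refl))))))))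
        where
        p≤q = ≤-trans p≤t t≤q
        k = fromℤ ⌊ p ⌋
        unit : ∀ {x} → ⌊ x ⌋ ≡ ⌊ p ⌋ → ∣ x - k ∣ ≤ 1#
        unit {x} eq = ∣∣-resp (+-congˡ (-‿cong (reflexive (≡.cong fromℤ eq)))) ≤-refl (∣frac∣≤1 x)

    u-bounded : ∀ x → x ∈[ fromℤ a , fromℤ b ] → ∣ u x ∣ ≤ G.bound + G′.bound
    u-bounded x x∈ = ∣∣-resp refl (+-mono-≤ ≤-refl (≤-reflexive (*-identityʳ G′.bound)))
      (∣∣-+ (G.bounded x x∈) (∣∣-* (G′.bounded x x∈) (∣frac∣≤1 x)))

    -- At the integer `r` that is crossed, the fractional part falls from 1 to 0 and the sum gains
    -- `g r`, so the two jumps of `Φ` cancel. `Φ-increment` makes this exact by splitting at `r`.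
    -- One `G.bound + G′.bound` comes from the Riemann term, the other from the increment of `Φ`.
    jump : ∀ {p t q} → fromℤ a ≤ p → t ∈[ p , q ] → q ≤ fromℤ b → ℤ.suc ⌊ p ⌋ ≡ ⌊ q ⌋ →
      ∣ Error u Φ p t q ∣ ≤ ((G.bound + G′.bound) + (G.bound + G′.bound)) * (q - p)
    jump {p} {t} {q} a≤p (p≤t , t≤q) q≤b next = ∣∣-resp refl
      (≤-by (*-nonNeg 0≤K (≤⇒0≤ r≤q))
        (solve 5 (λ M K p q r →
          ((M :+ K) :+ (M :+ K)) :* (q :- p) :-
            ((M :+ K) :* (q :- p) :+ ((M :* (q :- r) :+ K :* (r :- p)) :+ M :* (r :- p)))
          := K :* (q :- r)) refl G.bound G′.bound p q r))
      (∣∣-+ (∣∣-* (u-bounded t (≤-trans a≤p p≤t , ≤-trans t≤q q≤b)) (∣∣-nonNeg (≤⇒0≤ p≤q) ≤-refl))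
        (∣∣-neg (∣∣-resp (sym Φ-increment) ≤-refl
          (∣∣-+ (∣∣-+
            (∣∣-* (G.bounded q (≤-trans a≤p p≤q , q≤b)) (∣∣-nonNeg (≤⇒0≤ r≤q) ≤-refl))
            (increment-≤ derivative G′.bounded a≤p p≤r (≤-trans r≤q q≤b)))
            (∣∣-* (G.bounded p p∈) (∣∣-nonNeg (≤⇒0≤ p≤r) ≤-refl))))))
      where
      p≤q = ≤-trans p≤t t≤q
      k = ⌊ p ⌋
      r = fromℤ (ℤ.suc k)
      p∈ : p ∈[ fromℤ a , fromℤ b ]
      p∈ = a≤p , ≤-trans p≤q q≤b
      0≤K : 0# ≤ G′.bound
      0≤K = ∣∣-bound-nonNeg (G′.bounded p p∈)
      p≤r : p ≤ r
      p≤r = ≤-resp refl (sym (fromℤ-suc k)) (proj₁ (<⌊⌋+1 p))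
      r≤q : r ≤ q
      r≤q = ≤-resp (reflexive (≡.cong fromℤ (≡.sym next))) refl (⌊⌋≤ q)
      a≤k : a ℤ.≤ k
      a≤k = ≡.subst (ℤ._≤ k) (⌊fromℤ⌋ a) (⌊⌋-mono a≤p)
      Φ-increment : Φ q - Φ p ≈ (g q * (q - r) + (g r - g p)) + g p * (r - p)
      Φ-increment = trans
        (+-congʳ (trans (Φ-at (≡.sym next)) (+-congˡ (sumℤ-suc (λ m → g (fromℤ m)) a≤k))))
        (trans
          (solve 8 (λ gp gq gr p q r k S →
            (gq :* (q :- r) :+ (S :+ gr)) :- (gp :* (p :- k) :+ S)
            := (gq :* (q :- r) :+ (gr :- gp)) :+ gp :* ((k :+ con (+ 1)) :- p))
            refl (g p) (g q) (g r) p q r (fromℤ k) (S k))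
          (+-congˡ (*-congˡ (+-congʳ (sym (fromℤ-suc k))))))

    Φ-fromℤ : ∀ k → Φ (fromℤ k) ≈ S k
    Φ-fromℤ k = trans (Φ-at (⌊fromℤ⌋ k))
      (trans (+-congʳ (trans (*-congˡ (-‿inverseʳ (fromℤ k))) (zeroʳ _))) (+-identityˡ (S k)))

    summation : HasIntegral (fromℤ a) (fromℤ b) u (sumℤ a b (λ m → g (fromℤ m)))
    summation = integral-value
      (trans (+-cong (Φ-fromℤ b) (-‿cong (trans (Φ-fromℤ a) (sumℤ-empty a (λ m → g (fromℤ m))))))
        (trans (+-congˡ -0#≈0#) (+-identityʳ (S b))))
      (primitive⇒integral {Φ = Φ} (record { smooth = smooth ; jump = jump }))

  -- The summation formula in two variables

  module _
    (a b c d : ℤ) (a≤b : a ℤ.≤ b) (c≤d : c ℤ.≤ d) (f : ℝ → ℝ → ℝ)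
    (C² : HasContinuousPartials² (fromℤ a) (fromℤ b) (fromℤ c) (fromℤ d) f)
    where

    open HasContinuousPartials² C²

    A = fromℤ a
    B = fromℤ b
    C = fromℤ c
    D = fromℤ d

    A≤B : A ≤ B
    A≤B = fromℤ-mono a≤b

    C≤D : C ≤ D
    C≤D = fromℤ-mono c≤d

    fx-tame  = continuous⇒tame A≤B C≤D continuous-fx
    fy-tame  = continuous⇒tame A≤B C≤D continuous-fy
    fxy-tame = continuous⇒tame A≤B C≤D continuous-fxy
    f-tame   = bounded-partials⇒tame A≤B C≤D isPartial-fx isPartial-fy fx-tame fy-tame

    Σf Σfx : ℝ → ℝ
    Σf x = ∑[ c < n ≤ d ] f x (fromℤ n)
    Σfx x = ∑[ c < n ≤ d ] fx x (fromℤ n)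

    euler-summation :
      ∃[ I₁ ] ∃[ I₂ ] ∃[ I₃ ] ∃[ I₄ ]
        HasIteratedIntegral A B C D (λ x y → f x y) I₁ ×
        HasIteratedIntegral A B C D (λ x y → fx x y * frac x) I₂ ×
        HasIteratedIntegral A B C D (λ x y → fy x y * frac y) I₃ ×
        HasIteratedIntegral A B C D (λ x y → fxy x y * frac x * frac y) I₄ ×
        (∑[ c < n ≤ d ] ∑[ a < m ≤ b ] f (fromℤ m) (fromℤ n)) ≈ I₁ + I₂ + I₃ + I₄
    euler-summation =
      let I₁ , G₁ , inner₁ , outer₁ = tame⇒iterated-integrable C≤D f-tame
          I₂ , G₂ , inner₂ , outer₂ = tame⇒iterated-integrable C≤D (Tame₂-* fx-tame Tame₂-fracˣ)
          I₃ , G₃ , inner₃ , outer₃ = tame⇒iterated-integrable C≤D (Tame₂-* fy-tame Tame₂-fracʸ)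
          I₄ , G₄ , inner₄ , outer₄ = tame⇒iterated-integrable C≤D
            (Tame₂-* (Tame₂-* fxy-tame Tame₂-fracˣ) Tame₂-fracʸ)
      in I₁ , I₂ , I₃ , I₄ ,
         (G₁ , inner₁ , outer₁) , (G₂ , inner₂ , outer₂) , (G₃ , inner₃ , outer₃) , (G₄ , inner₄ , outer₄) ,
         integral-unique A≤B
           -- At fixed x the sum over n splits into a sum of `f` and a sum of `fx` times `frac x`.
           -- The formula in y turns the first into `G₁ x + G₃ x`. As `frac x` is constant in y, it
           -- moves under the inner integral and turns the second into `G₂ x + G₄ x`.
           (λ x x∈ → trans (split x)
             (trans (+-cong
               (integral-unique C≤D (λ _ _ → refl) (Σf-integral x x∈)
                 (integral-+ (inner₁ x x∈) (inner₃ x x∈)))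
               (integral-unique C≤D
                 (λ y _ → solve 4 (λ p q u v → (p :+ q :* v) :* u := p :* u :+ q :* u :* v)
                   refl (fx x y) (fxy x y) (frac x) (frac y))
                 (integral-* (frac x) (Σfx-integral x x∈))
                 (integral-+ (inner₂ x x∈) (inner₄ x x∈))))
             (solve 4 (λ p q r s → (p :+ q) :+ (r :+ s) := ((p :+ r) :+ q) :+ s)
               refl (G₁ x) (G₃ x) (G₂ x) (G₄ x))))
           outer-sum
           (integral-+ (integral-+ (integral-+ outer₁ outer₂) outer₃) outer₄)
      where
      open SemiringSum semiring using (*-distribʳ-sum)
      open CommutativeMonoidSum +-commutativeMonoid using (∑-distrib-+)

      -- The formula in x is applied along the lines y = n, which must lie in the rectangle where
      -- the derivatives are given.
      index∈ : (i : Fin ℤ.∣ d ℤ.- c ∣) → fromℤ (c ℤ.+ + suc (Fin.toℕ i)) ∈[ C , D ]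
      index∈ i = fromℤ-mono (ℤ.i≤i+j c _) , fromℤ-mono (begin
        c ℤ.+ + suc (Fin.toℕ i)      ≤⟨ ℤ.+-monoʳ-≤ c (ℤ.+≤+ (toℕ<n i)) ⟩
        c ℤ.+ + ℤ.∣ d ℤ.- c ∣        ≡⟨ ≡.cong (ℤ._+_ c) (ℤ.0≤i⇒+∣i∣≡i (ℤ.i≤j⇒0≤j-i c≤d)) ⟩
        c ℤ.+ (d ℤ.- c)              ≡⟨ ℤ.+-comm c _ ⟩
        d ℤ.- c ℤ.+ c                ≡⟨ ℤ.+-assoc d (ℤ.- c) c ⟩
        d ℤ.+ (ℤ.- c ℤ.+ c)          ≡⟨ ≡.cong (ℤ._+_ d) (ℤ.+-inverseˡ c) ⟩
        d ℤ.+ ℤ.0ℤ                   ≡⟨ ℤ.+-identityʳ d ⟩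
        d                            ∎)
        where open ℤ.≤-Reasoning

      outer-sum : HasIntegral A B
        (λ x → ∑[ c < n ≤ d ] (f x (fromℤ n) + fx x (fromℤ n) * frac x))
        (∑[ c < n ≤ d ] ∑[ a < m ≤ b ] f (fromℤ m) (fromℤ n))
      outer-sum = integral-sum ℤ.∣ d ℤ.- c ∣ _ _ λ i → Euler.summation a≤b
        (λ x x∈ → isPartial-fx x _ x∈ (index∈ i))
        (Tame₂-sliceˣ f-tame (index∈ i)) (Tame₂-sliceˣ fx-tame (index∈ i))

      Σf-integral : ∀ x → x ∈[ A , B ] → HasIntegral C D (λ y → f x y + fy x y * frac y) (Σf x)
      Σf-integral x x∈ = Euler.summation c≤d
        (λ y y∈ → isPartial-fy x y x∈ y∈) (Tame₂-sliceʸ f-tame x∈) (Tame₂-sliceʸ fy-tame x∈)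

      Σfx-integral : ∀ x → x ∈[ A , B ] → HasIntegral C D (λ y → fx x y + fxy x y * frac y) (Σfx x)
      Σfx-integral x x∈ = Euler.summation c≤d
        (λ y y∈ → isPartial-fxy x y x∈ y∈) (Tame₂-sliceʸ fx-tame x∈) (Tame₂-sliceʸ fxy-tame x∈)

      split : ∀ x →
        (∑[ c < n ≤ d ] (f x (fromℤ n) + fx x (fromℤ n) * frac x)) ≈ Σf x + Σfx x * frac x
      split x = trans (∑-distrib-+ {ℤ.∣ d ℤ.- c ∣} _ _)
        (+-congˡ (sym (*-distribʳ-sum {ℤ.∣ d ℤ.- c ∣} (frac x) _)))

corollary2 :
  (em : ExcludedMiddle 0ℓ) (R : CompleteOrderedField) →
  let open Analysis em R in
  (a b c d : ℤ) → a ℤ.< b → c ℤ.< d →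
  (f : ℝ → ℝ → ℝ) →
  (C² : HasContinuousPartials² (fromℤ a) (fromℤ b) (fromℤ c) (fromℤ d) f) →
  let open HasContinuousPartials² C²
      ∫∫ = HasIteratedIntegral (fromℤ a) (fromℤ b) (fromℤ c) (fromℤ d)
  in
  ∃[ I₁ ] ∃[ I₂ ] ∃[ I₃ ] ∃[ I₄ ]
    ∫∫ (λ x y → f x y) I₁ ×
    ∫∫ (λ x y → fx x y * (x - fromℤ ⌊ x ⌋)) I₂ ×
    ∫∫ (λ x y → fy x y * (y - fromℤ ⌊ y ⌋)) I₃ ×
    ∫∫ (λ x y → fxy x y * (x - fromℤ ⌊ x ⌋) * (y - fromℤ ⌊ y ⌋)) I₄ ×
    (∑[ c < n ≤ d ] ∑[ a < m ≤ b ] f (fromℤ m) (fromℤ n)) ≈ I₁ + I₂ + I₃ + I₄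
corollary2 em R a b c d a<b c<d f C² =
  Proof.euler-summation em R a b c d (ℤ.<⇒≤ a<b) (ℤ.<⇒≤ c<d) f C²
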